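{- For every constant $\varepsilon\in(0,1)$ there is a constant $K=K(\varepsilon)$ such that for every $n\ge2$ and all admissible vertex weights there is a deterministic online algorithm $\mathcal A$ for capacitated online $2$-recoloring on $n$ weighted vertices, using capacity $(1+\varepsilon)B$ for each of the two colors, where $B=\frac12\sum_{v\in V}w(v)$, that is $O(\log n)$-competitive against an optimal offline algorithm using capacity $B$ for each color; that is, for every admissible request sequence $\sigma$, $$\mathcal A_\sigma\le K\log n\cdot OPT_\sigma .$$
   Context: Capacitated online $2$-recoloring. There is a fixed set $V$ of $n$ vertices with weights $w(v)$ which are positive integers, such that $\sum_{v\in V}w(v)$ is even and $w(v)\le B:=\frac12\sum_{u\in V}w(u)$ for every $v$ (admissible weights). An initial coloring $c_0:V\to\{1,2\}$ is given in which each color class has total weight at most $B$. A finite sequence $\sigma=(\sigma_1,\dots,\sigma_T)$ of edges $\sigma_t=(u_t,v_t)$ between vertices of $V$ is revealed one at a time. Let $G_t$ be the graph on $V$ with edges $\sigma_1,\dots,\sigma_t$. The sequence is admissible if $G_T$ has a proper $2$-coloring in which each color class has total weight at most $B$. After each request $\sigma_t$ the algorithm must output a proper $2$-coloring $c_t$ of $G_t$, and the total weight of the vertices of each color must not exceed the algorithm's capacity at any time. Recoloring a vertex $v$ costs $w(v)$, so the total cost is $\sum_{t=1}^T\sum_{v:\,c_t(v)\ne c_{t-1}(v)}w(v)$. A deterministic online algorithm determines $c_t$ from $V,w,c_0$ and $\sigma_1,\dots,\sigma_t$ only. $\mathcal A_\sigma$ denotes the total cost of $\mathcal A$ on $\sigma$,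 where $\mathcal A$ has capacity $(1+\varepsilon)B$ per color ($(1+\varepsilon)$-resource augmentation). $OPT_\sigma$ denotes the minimum total cost of an offline algorithm (which knows all of $\sigma$ in advance) that has capacity $B$ per color. -}

module Defs where

open import Algebra.Properties.CommutativeMonoid.Sum using (sum)
open import Data.Bool.Base using (if_then_else_)
open import Data.Fin.Base using (Fin; toℕ; inject₁)
open import Data.Fin.Properties using (_≟_)
open import Data.Integer.Base using (+_)
open import Data.List.Base using (List; length; take)
open import Data.List.Relation.Unary.All using (All)
open import Data.Nat.Base as ℕ using (ℕ)
open import Data.Nat.Divisibility using (_∣_)
open import Data.Nat.DivMod using () renaming (_/_ to _div_)
open import Data.Nat.Properties using (+-0-commutativeMonoid)
open import Data.Product.Base using (_×_; _,_; ∃-syntax)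
open import Data.Rational.Base as ℚ using (ℚ; 0ℚ; 1ℚ)
open import Data.Sum.Base using (_⊎_)
open import Data.Vec.Functional using (Vector; _∷_)
open import Function.Bundles using (_⇔_)
open import Relation.Binary.PropositionalEquality.Core using (_≡_; _≢_)
open import Relation.Nullary using (¬_; does)

-- Dedekind reals: Lower q means q < x, Upper q means x < q.
record ℝ : Set₁ where
  field
    Lower Upper     : ℚ → Set
    lower-inhabited : ∃[ q ] Lower q
    upper-inhabited : ∃[ q ] Upper q
    lower-rounded   : ∀ p → Lower p ⇔ (∃[ q ] (p ℚ.< q × Lower q))
    upper-rounded   : ∀ q → Upper q ⇔ (∃[ p ] (p ℚ.< q × Upper p))
    disjoint        : ∀ q → ¬ (Lower q × Upper q)
    located         : ∀ p q → p ℚ.< q → Lower p ⊎ Upper q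

_∈⟨0,1⟩ : ℝ → Set
ε ∈⟨0,1⟩ = ℝ.Lower ε 0ℚ × ℝ.Upper ε 1ℚ

∑ : ∀ {n} → Vector ℕ n → ℕ
∑ = sum +-0-commutativeMonoid

Weights : ℕ → Set
Weights n = Vector ℕ n

Color : Set
Color = Fin 2

Coloring : ℕ → Set
Coloring n = Fin n → Color

Edge : ℕ → Set
Edge n = Fin n × Fin n

half : ∀ {n} → Weights n → ℕ
half w = ∑ w div 2

record AdmissibleWeights {n} (w : Weights n) : Set where
  field
    positive : ∀ v → 0 ℕ.< w v
    even     : 2 ∣ ∑ w
    bounded  : ∀ v → w v ℕ.≤ half w

classWeight : ∀ {n} → Weights n → Coloring n → Color → ℕ
classWeight w c i = ∑ λ v → if does (c v ≟ i) then w v else 0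

-- A capacity is given by the set of loads it allows, so that real capacities
-- can be used for natural-number loads.
Capacity : Set₁
Capacity = ℕ → Set

exactly : ℕ → Capacity
exactly B m = m ℕ.≤ B

-- m ≤ (1 + ε) B, with 1 + ε approached by the rationals 1 + q, q > ε.
augmented : ℝ → ℕ → Capacity
augmented ε B m =
  ∀ q → ℝ.Upper ε q → (+ m ℚ./ 1) ℚ.≤ (1ℚ ℚ.+ q) ℚ.* (+ B ℚ./ 1)

Respects : ∀ {n} → Weights n → Capacity → Coloring n → Set
Respects w cap c = ∀ i → cap (classWeight w c i)

Proper : ∀ {n} → List (Edge n) → Coloring n → Set
Proper es c = All (λ (u , v) → c u ≢ c v) es

AdmissibleRequests : ∀ {n} → Weights n → List (Edge n) → Set
AdmissibleRequests w σ = ∃[ c ] (Proper σ c × Respects w (exactly (half w)) c)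

-- With T = length σ, the entry at t : Fin T is the coloring output after
-- request number suc (toℕ t), the first request having number 1.
Schedule : ∀ {n} → List (Edge n) → Set
Schedule {n} σ = Vector (Coloring n) (length σ)

prefix : ∀ {n} (σ : List (Edge n)) → Fin (length σ) → List (Edge n)
prefix σ t = take (ℕ.suc (toℕ t)) σ

Feasible : ∀ {n} → Weights n → Capacity → (σ : List (Edge n)) → Schedule σ → Set
Feasible w cap σ c = ∀ t → Proper (prefix σ t) (c t) × Respects w cap (c t)

recoloringCost : ∀ {n} → Weights n → Coloring n → Coloring n → ℕ
recoloringCost w c c′ = ∑ λ v → if does (c v ≟ c′ v) then 0 else w v

cost : ∀ {n} → Weights n → Coloring n → (σ : List (Edge n)) → Schedule σ → ℕ
cost w c₀ σ c = ∑ λ t → recoloringCost w ((c₀ ∷ c) (inject₁ t)) (c t)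

record IsOPT {n} (w : Weights n) (c₀ : Coloring n) (σ : List (Edge n))
             (opt : ℕ) : Set where
  field
    attained : ∃[ c ] (Feasible w (exactly (half w)) σ c × cost w c₀ σ c ≡ opt)
    minimal  : ∀ c → Feasible w (exactly (half w)) σ c → opt ℕ.≤ cost w c₀ σ c

-- A deterministic online algorithm for fixed weights: it sees the initial
-- coloring and the requests revealed so far.
OnlineAlgorithm : ℕ → Set
OnlineAlgorithm n = Coloring n → List (Edge n) → Coloring n

run : ∀ {n} → OnlineAlgorithm n → Coloring n → (σ : List (Edge n)) → Schedule σ
run A c₀ σ t = A c₀ (prefix σ t)

{-# OPTIONS --safe #-}
module Submission where

-- The algorithm has two regimes.  In the lazy one every component of G_t having
-- a proper coloring that differs from c₀ on less than a fifth of its weight gets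
-- that coloring; where this leaves a choice at a monochromatic edge, the
-- component with fewer vertices is flipped.  Flips that bring a component
-- back towards c₀ are paid by the decrease of the distance to c₀, the
-- small-to-large flips by log₂ of the component size.  So the cost is
-- O(log n) · D, where D is the sum over the components of the distance of c₀ to
-- the closest proper coloring, and D ≤ OPT.  The distance to c₀ stays below 4 D,
-- so the capacity is only exceeded once OPT = Ω(ε B).
-- From then on components are merged small-to-large, which costs at most
-- 2 B log₂ n in total, and whenever the capacity is exceeded all vertices are
-- recolored to an arbitrary balanced coloring.  This costs at most 2 B, but
-- flips of total weight ε B have happened since the previous such recoloring.

open import Defs
open import Data.Bool.Base using (Bool; true; false; if_then_else_; _xor_)
open import Data.List.Base using (List; []; _∷_; foldl)
open import Data.Nat.Base
  using (ℕ; zero; suc; _+_; _*_; _⊓_; _≤_; _<_; z≤n; s≤s; >-nonZero)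
open import Data.Nat.DivMod using (m/n*n≡m)
open import Data.Nat.Logarithm
  using (⌊log₂_⌋; ⌊log₂⌋-mono-≤; ⌊log₂[2*b]⌋≡1+⌊log₂b⌋; ⌊log₂[2^n]⌋≡n)
open import Data.Nat.Properties hiding (_≟_)
open import Algebra.Properties.CommutativeSemigroup +-commutativeSemigroup using (interchange)
open import Data.Nat.Tactic.RingSolver using (solve)
open import Data.Product.Base using (_×_; _,_; proj₁; proj₂; ∃-syntax)
open import Data.Sum.Base using (inj₁; inj₂)
open import Relation.Binary.PropositionalEquality

-- Arithmetic of contested weights and amortised costs

infixl 6 _⊕_
infixl 7 _⊛_ _⊗_

_⊕_ : ∀ {a b c d} → a ≤ b → c ≤ d → a + c ≤ b + d
_⊕_ = +-mono-≤

_⊛_ : ∀ k {a b} → a ≤ b → k * a ≤ k * b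
k ⊛ p = *-monoʳ-≤ k p

_⊗_ : ∀ {a b c d} → a ≤ b → c ≤ d → a * c ≤ b * d
_⊗_ = *-mono-≤

-- A linear combination x ≤ y of known inequalities yields P ≤ Q as soon as
-- Q − P = (y − x) + s.
linear : ∀ {x y P Q} s → x ≤ y → P + y + s ≡ Q + x → P ≤ Q
linear {x} {y} {P} {Q} s x≤y eq = +-cancelʳ-≤ x P Q (begin
  P + x      ≤⟨ +-monoʳ-≤ P x≤y ⟩
  P + y      ≤⟨ m≤m+n (P + y) s ⟩
  P + y + s  ≡⟨ eq ⟩
  Q + x      ∎)
  where open ≤-Reasoning

-- With a and b the weights of a component recolored and not recolored by the
-- current coloring relative to c₀: min (a + b, 5 a, 5 b), in a form that is
-- visibly superadditive.
contested : ℕ → ℕ → ℕ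
contested a b = (a ⊓ (4 * b)) + (b ⊓ (4 * a))

contested-comm : ∀ a b → contested a b ≡ contested b a
contested-comm a b = +-comm (a ⊓ (4 * b)) (b ⊓ (4 * a))

contested≤total : ∀ a b → contested a b ≤ a + b
contested≤total a b = m⊓n≤m a (4 * b) ⊕ m⊓n≤m b (4 * a)

contested≤5b : ∀ a b → contested a b ≤ 5 * b
contested≤5b a b = begin
  contested a b  ≤⟨ m⊓n≤n a (4 * b) ⊕ m⊓n≤m b (4 * a) ⟩
  4 * b + b      ≡⟨ +-comm (4 * b) b ⟩
  5 * b          ∎
  where open ≤-Reasoning

contested≤5a : ∀ a b → contested a b ≤ 5 * a
contested≤5a a b = subst (_≤ 5 * a) (contested-comm b a) (contested≤5b b a)

contested-total : ∀ {a b} → a ≤ 4 * b → b ≤ 4 * a → contested a b ≡ a + b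
contested-total p q = cong₂ _+_ (m≤n⇒m⊓n≡m p) (m≤n⇒m⊓n≡m q)

4m≤n⇒m≤4n : ∀ {m n} → 4 * m ≤ n → m ≤ 4 * n
4m≤n⇒m≤4n {m} {n} p = linear (15 * m) (4 ⊛ p) (solve (m ∷ n ∷ []))

contested-decided : ∀ {a b} → 4 * a ≤ b → contested a b ≡ 5 * a
contested-decided {a} {b} p = cong₂ _+_ (m≤n⇒m⊓n≡m (4m≤n⇒m≤4n {a} p)) (m≥n⇒m⊓n≡n p)

-- A minimum of two linear functions is superadditive, and `contested` is a sum of two such minima.
-- This keeps the potential from dropping when components merge unflipped.
contested-superadditive : ∀ a₁ b₁ a₂ b₂ →
  contested a₁ b₁ + contested a₂ b₂ ≤ contested (a₁ + a₂) (b₁ + b₂)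
contested-superadditive a₁ b₁ a₂ b₂ = begin
  (a₁ ⊓ (4 * b₁) + b₁ ⊓ (4 * a₁)) + (a₂ ⊓ (4 * b₂) + b₂ ⊓ (4 * a₂))
    ≡⟨ interchange (a₁ ⊓ (4 * b₁)) _ _ _ ⟩
  (a₁ ⊓ (4 * b₁) + a₂ ⊓ (4 * b₂)) + (b₁ ⊓ (4 * a₁) + b₂ ⊓ (4 * a₂))
    ≤⟨ ⊓-superadditive a₁ b₁ a₂ b₂ ⊕ ⊓-superadditive b₁ a₁ b₂ a₂ ⟩
  contested (a₁ + a₂) (b₁ + b₂) ∎
  where
  open ≤-Reasoning
  ⊓-superadditive : ∀ a b c d → a ⊓ (4 * b) + c ⊓ (4 * d) ≤ (a + c) ⊓ (4 * (b + d))
  ⊓-superadditive a b c d = ⊓-glb (m⊓n≤m a _ ⊕ m⊓n≤m c _)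
    (≤-trans (m⊓n≤n a _ ⊕ m⊓n≤n c _) (≤-reflexive (sym (*-distribˡ-+ 4 b d))))

-- `p` will be a level growing with the logarithm of the component size. The factor 3 is what a free
-- flip asks for: its cost and the change of credit add up to 3 b₁ - a₁, while one more level yields
-- 3 (a₁ + b₁).
potential : ℕ → ℕ → ℕ → ℕ
potential a b p = 3 * (contested a b * p)

flipCost : Bool → ℕ → ℕ
flipCost x m = if x then m else 0

swapIf : Bool → ℕ → ℕ → ℕ
swapIf x a b = if x then b else a

module _ (a₁ b₁ p₁ a₂ b₂ p₂ p : ℕ) where

  -- Flipping the first component if x and the second if y, and then merging
  -- them, has amortised cost at most 0 and leaves the merged component close to c₀.
  Pays : Bool → Bool → Set
  Pays x y = a′ ≤ 4 * b′ ×
    flipCost x (a₁ + b₁) + flipCost y (a₂ + b₂) + 2 * a′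
      + (potential a₁ b₁ p₁ + potential a₂ b₂ p₂)
    ≤ 2 * (a₁ + a₂) + potential a′ b′ p
    where
    a′ = swapIf x a₁ b₁ + swapIf y a₂ b₂
    b′ = swapIf x b₁ a₁ + swapIf y b₂ a₂

potential-superadditive : ∀ a₁ b₁ p₁ a₂ b₂ p₂ p → p₁ ≤ p → p₂ ≤ p →
  potential a₁ b₁ p₁ + potential a₂ b₂ p₂ ≤ potential (a₁ + a₂) (b₁ + b₂) p
potential-superadditive a₁ b₁ p₁ a₂ b₂ p₂ p p₁≤p p₂≤p = begin
  potential a₁ b₁ p₁ + potential a₂ b₂ p₂
    ≤⟨ 3 ⊛ (contested a₁ b₁ ⊛ p₁≤p) ⊕ 3 ⊛ (contested a₂ b₂ ⊛ p₂≤p) ⟩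
  3 * (contested a₁ b₁ * p) + 3 * (contested a₂ b₂ * p)
    ≡⟨ *-distribˡ-+ 3 (contested a₁ b₁ * p) _ ⟨
  3 * (contested a₁ b₁ * p + contested a₂ b₂ * p)
    ≡⟨ cong (3 *_) (*-distribʳ-+ p (contested a₁ b₁) _) ⟨
  3 * ((contested a₁ b₁ + contested a₂ b₂) * p)
    ≤⟨ 3 ⊛ *-monoˡ-≤ p (contested-superadditive a₁ b₁ a₂ b₂) ⟩
  potential (a₁ + a₂) (b₁ + b₂) p         ∎
  where open ≤-Reasoning

pays-keep : ∀ a₁ b₁ p₁ a₂ b₂ p₂ p → p₁ ≤ p → p₂ ≤ p → a₁ + a₂ ≤ 4 * (b₁ + b₂) →
  Pays a₁ b₁ p₁ a₂ b₂ p₂ p false false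
pays-keep a₁ b₁ p₁ a₂ b₂ p₂ p p₁≤p p₂≤p fits =
  fits , +-monoʳ-≤ (2 * (a₁ + a₂)) (potential-superadditive a₁ b₁ p₁ a₂ b₂ p₂ p p₁≤p p₂≤p)

-- With a and b the total recolored and unrecolored weights, the flip costs a + b and releases the
-- credit 2 a - 2 b, which suffices once 3 b ≤ a. The potential ignores the flip because `contested`
-- is symmetric.
pays-flip-both : ∀ a₁ b₁ p₁ a₂ b₂ p₂ p → p₁ ≤ p → p₂ ≤ p → 4 * (b₁ + b₂) ≤ a₁ + a₂ →
  Pays a₁ b₁ p₁ a₂ b₂ p₂ p true true
pays-flip-both a₁ b₁ p₁ a₂ b₂ p₂ p p₁≤p p₂≤p 4b≤a =
  4m≤n⇒m≤4n {b₁ + b₂} 4b≤a ,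
  pay (≤-trans (potential-superadditive a₁ b₁ p₁ a₂ b₂ p₂ p p₁≤p p₂≤p)
        (≤-reflexive (cong (λ u → 3 * (u * p)) (contested-comm (a₁ + a₂) (b₁ + b₂)))))
  where
  pay : ∀ {P P′} → P ≤ P′ →
    a₁ + b₁ + (a₂ + b₂) + 2 * (b₁ + b₂) + P ≤ 2 * (a₁ + a₂) + P′
  pay {P} {P′} P≤P′ =
    linear (b₁ + b₂) (4b≤a ⊕ P≤P′) (solve (a₁ ∷ a₂ ∷ b₁ ∷ b₂ ∷ P ∷ P′ ∷ []))

-- After the flip at most a fifth of the merged component is recolored, so its contested weight is 5
-- (b₁ + a₂). The share 5 a₂ absorbs the potential of the second component; the share 5 b₁ has to
-- cover that of the first and the flip.
pays-flip-forced : ∀ a₁ b₁ p₁ a₂ b₂ p₂ p → 1 ≤ p₁ → p₁ ≤ p → p₂ ≤ p →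
  4 * (b₁ + a₂) ≤ a₁ + b₂ → Pays a₁ b₁ p₁ a₂ b₂ p₂ p true false
pays-flip-forced a₁ b₁ p₁ a₂ b₂ p₂ p 1≤p₁ p₁≤p p₂≤p 4a≤b =
  4m≤n⇒m≤4n {b₁ + a₂} 4a≤b ,
  ≤-trans (pay (contested≤total a₁ b₁) (contested≤5b a₁ b₁) (contested≤5a a₂ b₂))
    (≤-reflexive (cong (λ u → 2 * (a₁ + a₂) + 3 * (u * p))
      (sym (contested-decided {b₁ + a₂} 4a≤b))))
  where
  -- In subtractive form: c p - u p₁ ≥ c - u.
  gain : ∀ {u c} → u ≤ c → 1 ≤ p → u * p₁ + c ≤ u + c * p
  gain {u} u≤c (s≤s {n = e} z≤n) with m≤n⇒∃[o]m+o≡n u≤c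
  ... | x , refl = linear (x * e) (u ⊛ p₁≤p) (solve (u ∷ p₁ ∷ x ∷ e ∷ []))
  pay : ∀ {u₁ u₂} → u₁ ≤ a₁ + b₁ → u₁ ≤ 5 * b₁ → u₂ ≤ 5 * a₂ →
    a₁ + b₁ + 0 + 2 * (b₁ + a₂) + (3 * (u₁ * p₁) + 3 * (u₂ * p₂))
      ≤ 2 * (a₁ + a₂) + 3 * (5 * (b₁ + a₂) * p)
  pay {u₁} {u₂} h₁ h₂ h₃ =
    -- Flip and credit need 3 b₁ - a₁. One use of u₁ ≤ a₁ + b₁ and two of u₁ ≤ 5 b₁ give 3 u₁ ≤ a₁ +
    -- 11 b₁, so the gain 15 b₁ - 3 u₁ leaves b₁ to spare.
    linear b₁ (h₁ ⊕ 2 ⊛ h₂ ⊕ 3 ⊛ gain h₂ (≤-trans 1≤p₁ p₁≤p) ⊕ 3 ⊛ (h₃ ⊗ p₂≤p))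
      (solve (a₁ ∷ a₂ ∷ b₁ ∷ b₂ ∷ u₁ ∷ u₂ ∷ p₁ ∷ p₂ ∷ p ∷ []))

-- Neither coloring of the merged component is clearly closer to c₀, so its whole weight is
-- contested, and the flipped component gains a level on all of its weight.
pays-flip-free : ∀ a₁ b₁ p₁ a₂ b₂ p₂ p → suc p₁ ≤ p → p₂ ≤ p →
  b₁ + a₂ ≤ 4 * (a₁ + b₂) → a₁ + b₂ ≤ 4 * (b₁ + a₂) → Pays a₁ b₁ p₁ a₂ b₂ p₂ p true false
pays-flip-free a₁ b₁ p₁ a₂ b₂ p₂ p p₁<p p₂≤p a≤4b b≤4a =
  a≤4b ,
  ≤-trans (pay (contested≤total a₁ b₁) (contested≤total a₂ b₂))
    (≤-reflexive (cong (λ u → 2 * (a₁ + a₂) + 3 * (u * p))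
      (sym (contested-total {b₁ + a₂} {a₁ + b₂} a≤4b b≤4a))))
  where
  pay : ∀ {u₁ u₂} → u₁ ≤ a₁ + b₁ → u₂ ≤ a₂ + b₂ →
    a₁ + b₁ + 0 + 2 * (b₁ + a₂) + (3 * (u₁ * p₁) + 3 * (u₂ * p₂))
      ≤ 2 * (a₁ + a₂) + 3 * ((b₁ + a₂ + (a₁ + b₂)) * p)
  pay {u₁} {u₂} h₁ h₂ =
    linear (4 * a₁) (3 ⊛ (h₁ ⊗ ≤-refl {p₁}) ⊕ 3 ⊛ ((a₁ + b₁) ⊛ p₁<p) ⊕ 3 ⊛ (h₂ ⊗ p₂≤p))
      (solve (a₁ ∷ a₂ ∷ b₁ ∷ b₂ ∷ u₁ ∷ u₂ ∷ p₁ ∷ p₂ ∷ p ∷ []))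

pays-swap : ∀ a₁ b₁ p₁ a₂ b₂ p₂ p x y → Pays a₂ b₂ p₂ a₁ b₁ p₁ p y x → Pays a₁ b₁ p₁ a₂ b₂ p₂ p x y
pays-swap a₁ b₁ p₁ a₂ b₂ p₂ p x y (balanced , pays)
  rewrite +-comm (swapIf x a₁ b₁) (swapIf y a₂ b₂) | +-comm (swapIf x b₁ a₁) (swapIf y b₂ a₂)
        | +-comm (flipCost x (a₁ + b₁)) (flipCost y (a₂ + b₂))
        | +-comm (potential a₁ b₁ p₁) (potential a₂ b₂ p₂) | +-comm a₁ a₂
  = balanced , pays

-- The absorbed label is empty afterwards: its recolored weight is the literal 0, and `Z` is the
-- potential left on it.
lazy-regroup : ∀ x₁ x₂ a a₁ a₂ P₁ P₂ P Z → x₁ + x₂ + 2 * a + (P₁ + P₂) ≤ 2 * (a₁ + a₂) + P →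
  (x₁ + 2 * a + P₁) + (x₂ + 0 + P₂) ≤ (2 * a₁ + P) + (2 * a₂ + Z)
lazy-regroup x₁ x₂ a a₁ a₂ P₁ P₂ P Z h =
  linear Z h (solve (x₁ ∷ x₂ ∷ a ∷ a₁ ∷ a₂ ∷ P₁ ∷ P₂ ∷ P ∷ Z ∷ []))

lazy-combine : ∀ T R M M′ F F′ → R + 2 * M′ + F ≤ 2 * M + F′ → T + 2 * M ≤ F → T + R + 2 * M′ ≤ F′
lazy-combine T R M M′ F F′ h₁ h₂ =
  linear 0 (h₁ ⊕ h₂) (solve (T ∷ R ∷ M ∷ M′ ∷ F ∷ F′ ∷ []))

eager-regroup : ∀ x₁ x₂ P₁ P₂ P Z → x₁ + x₂ + (P₁ + P₂) ≤ P → (x₁ + P₁) + (x₂ + P₂) ≤ P + Z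
eager-regroup x₁ x₂ P₁ P₂ P Z h = linear Z h (solve (x₁ ∷ x₂ ∷ P₁ ∷ P₂ ∷ P ∷ Z ∷ []))

-- A flip of cost `R` adds `R` to the cost and 2 m R to the credit for the excess, hence the factor
-- 2 m + 1 on the potential.
eager-combine : ∀ m T R S S′ e Z → R + S ≤ S′ → T + 2 * m * e ≤ Z + suc (2 * m) * S →
  T + R + 2 * m * (e + R) ≤ Z + suc (2 * m) * S′
eager-combine m T R S S′ e Z h₁ h₂ =
  linear 0 (suc (2 * m) ⊛ h₁ ⊕ h₂) (solve (m ∷ T ∷ R ∷ S ∷ S′ ∷ e ∷ Z ∷ []))

-- Logarithmic levels and the choice of the flip

level : ℕ → ℕ
level k = suc ⌊log₂ k ⌋

log-double : ∀ {j k} → 0 < j → j ≤ k → suc ⌊log₂ j ⌋ ≤ ⌊log₂ (j + k) ⌋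
log-double {j} {k} 0<j j≤k = begin
  suc ⌊log₂ j ⌋    ≡⟨ ⌊log₂[2*b]⌋≡1+⌊log₂b⌋ j {{>-nonZero 0<j}} ⟨
  ⌊log₂ (2 * j) ⌋  ≤⟨ ⌊log₂⌋-mono-≤ (+-monoʳ-≤ j (≤-trans (≤-reflexive (+-identityʳ j)) j≤k)) ⟩
  ⌊log₂ (j + k) ⌋  ∎
  where open ≤-Reasoning

log-doubleʳ : ∀ {j k} → 0 < k → k ≤ j → suc ⌊log₂ k ⌋ ≤ ⌊log₂ (j + k) ⌋
log-doubleʳ {j} {k} 0<k k≤j =
  subst (λ i → suc ⌊log₂ k ⌋ ≤ ⌊log₂ i ⌋) (+-comm k j) (log-double 0<k k≤j)

-- `z` tells whether the new edge is monochromatic. With the flips `x` and `x xor z` exactly one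
-- component is flipped if it is, and both or none otherwise.
lazyChoice : ∀ z a₁ b₁ k₁ a₂ b₂ k₂ → 0 < k₁ → 0 < k₂ →
  ∃[ x ] Pays a₁ b₁ (level k₁) a₂ b₂ (level k₂) (level (k₁ + k₂)) x (x xor z)
lazyChoice z a₁ b₁ k₁ a₂ b₂ k₂ 0<k₁ 0<k₂ = choose z
  where
  l₁ = level k₁
  l₂ = level k₂
  l = level (k₁ + k₂)
  l₁≤l : l₁ ≤ l
  l₁≤l = s≤s (⌊log₂⌋-mono-≤ (m≤m+n k₁ k₂))
  l₂≤l : l₂ ≤ l
  l₂≤l = s≤s (⌊log₂⌋-mono-≤ (m≤n+m k₂ k₁))
  choose : ∀ z → ∃[ x ] Pays a₁ b₁ l₁ a₂ b₂ l₂ l x (x xor z)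
  choose false with ≤-total (a₁ + a₂) (4 * (b₁ + b₂))
  ... | inj₁ a≤4b = false , pays-keep a₁ b₁ l₁ a₂ b₂ l₂ l l₁≤l l₂≤l a≤4b
  ... | inj₂ 4b≤a = true , pays-flip-both a₁ b₁ l₁ a₂ b₂ l₂ l l₁≤l l₂≤l 4b≤a
  -- A flip that brings the merged component close to c₀ has priority, whatever the sizes; only if
  -- neither flip does so is the smaller component flipped.
  choose true with ≤-total (4 * (b₁ + a₂)) (a₁ + b₂) | ≤-total (4 * (b₂ + a₁)) (a₂ + b₁)
  ... | inj₁ forced | _ = true , pays-flip-forced a₁ b₁ l₁ a₂ b₂ l₂ l (s≤s z≤n) l₁≤l l₂≤l forced
  ... | inj₂ _ | inj₁ forced = false , pays-swap a₁ b₁ l₁ a₂ b₂ l₂ l false true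
        (pays-flip-forced a₂ b₂ l₂ a₁ b₁ l₁ l (s≤s z≤n) l₂≤l l₁≤l forced)
  ... | inj₂ free₁ | inj₂ free₂ with ≤-total k₁ k₂
  ...   | inj₁ k₁≤k₂ = true , pays-flip-free a₁ b₁ l₁ a₂ b₂ l₂ l (s≤s (log-double 0<k₁ k₁≤k₂)) l₂≤l
          (subst₂ (λ i j → i ≤ 4 * j) (+-comm a₂ b₁) (+-comm b₂ a₁) free₂) free₁
  ...   | inj₂ k₂≤k₁ = false , pays-swap a₁ b₁ l₁ a₂ b₂ l₂ l false true
          (pays-flip-free a₂ b₂ l₂ a₁ b₁ l₁ l (s≤s (log-doubleʳ 0<k₂ k₂≤k₁)) l₁≤l
            (subst₂ (λ i j → i ≤ 4 * j) (+-comm a₁ b₂) (+-comm b₁ a₂) free₁) free₂)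

-- A flipped component has at most half of the vertices of the union, so its logarithm grows by at
-- least one, which pays for its weight.
eagerChoice : ∀ z W₁ k₁ W₂ k₂ → 0 < k₁ → 0 < k₂ →
  ∃[ x ] flipCost x W₁ + flipCost (x xor z) W₂ + (W₁ * ⌊log₂ k₁ ⌋ + W₂ * ⌊log₂ k₂ ⌋)
           ≤ (W₁ + W₂) * ⌊log₂ (k₁ + k₂) ⌋
eagerChoice z W₁ k₁ W₂ k₂ 0<k₁ 0<k₂ = choose z
  where
  l₁≤l : ⌊log₂ k₁ ⌋ ≤ ⌊log₂ (k₁ + k₂) ⌋
  l₁≤l = ⌊log₂⌋-mono-≤ (m≤m+n k₁ k₂)
  l₂≤l : ⌊log₂ k₂ ⌋ ≤ ⌊log₂ (k₁ + k₂) ⌋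
  l₂≤l = ⌊log₂⌋-mono-≤ (m≤n+m k₂ k₁)
  keep : ∀ {l₁ l₂ l} → l₁ ≤ l → l₂ ≤ l → W₁ * l₁ + W₂ * l₂ ≤ (W₁ + W₂) * l
  keep {l₁} {l₂} {l} h₁ h₂ = linear 0 (W₁ ⊛ h₁ ⊕ W₂ ⊛ h₂) (solve (W₁ ∷ W₂ ∷ l₁ ∷ l₂ ∷ l ∷ []))
  flip₁ : ∀ {l₁ l₂ l} → l₁ < l → l₂ ≤ l → W₁ + 0 + (W₁ * l₁ + W₂ * l₂) ≤ (W₁ + W₂) * l
  flip₁ {l₁} {l₂} {l} h₁ h₂ = linear 0 (W₁ ⊛ h₁ ⊕ W₂ ⊛ h₂) (solve (W₁ ∷ W₂ ∷ l₁ ∷ l₂ ∷ l ∷ []))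
  flip₂ : ∀ {l₁ l₂ l} → l₁ ≤ l → l₂ < l → W₂ + (W₁ * l₁ + W₂ * l₂) ≤ (W₁ + W₂) * l
  flip₂ {l₁} {l₂} {l} h₁ h₂ = linear 0 (W₁ ⊛ h₁ ⊕ W₂ ⊛ h₂) (solve (W₁ ∷ W₂ ∷ l₁ ∷ l₂ ∷ l ∷ []))
  choose : ∀ z → ∃[ x ] flipCost x W₁ + flipCost (x xor z) W₂ + (W₁ * ⌊log₂ k₁ ⌋ + W₂ * ⌊log₂ k₂ ⌋)
                          ≤ (W₁ + W₂) * ⌊log₂ (k₁ + k₂) ⌋
  choose false = false , keep l₁≤l l₂≤l
  choose true with ≤-total k₁ k₂
  ... | inj₁ k₁≤k₂ = true , flip₁ (log-double 0<k₁ k₁≤k₂) l₂≤l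
  ... | inj₂ k₂≤k₁ = false , flip₂ l₁≤l (log-doubleʳ 0<k₂ k₂≤k₁)

-- Constants of the competitive ratio

potential≤ : ∀ a b {p l} → p ≤ l → potential a b p ≤ 15 * l * (a ⊓ b)
potential≤ a b {p} {l} p≤l = begin
  3 * (contested a b * p)   ≤⟨ 3 ⊛ (contested≤5⊓ ⊗ p≤l) ⟩
  3 * (5 * (a ⊓ b) * l)     ≡⟨ regroup (a ⊓ b) ⟩
  15 * l * (a ⊓ b)          ∎
  where
  open ≤-Reasoning
  contested≤5⊓ : contested a b ≤ 5 * (a ⊓ b)
  contested≤5⊓ with ≤-total a b
  ... | inj₁ a≤b = subst (λ d → contested a b ≤ 5 * d) (sym (m≤n⇒m⊓n≡m a≤b)) (contested≤5a a b)
  ... | inj₂ b≤a = subst (λ d → contested a b ≤ 5 * d) (sym (m≥n⇒m⊓n≡n b≤a)) (contested≤5b a b)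
  regroup : ∀ d → 3 * (5 * d * l) ≡ 15 * l * d
  regroup d = solve (d ∷ l ∷ [])

m≤4[m⊓n] : ∀ {m n} → m ≤ 4 * n → m ≤ 4 * (m ⊓ n)
m≤4[m⊓n] {m} {n} m≤4n with ≤-total m n
... | inj₁ m≤n = subst (λ d → m ≤ 4 * d) (sym (m≤n⇒m⊓n≡m m≤n)) (m≤m+n m _)
... | inj₂ n≤m = subst (λ d → m ≤ 4 * d) (sym (m≥n⇒m⊓n≡n n≤m)) m≤4n

overflow-excess : ∀ m B e x → suc m * B < m * x → x ≤ B + e → B ≤ m * e
overflow-excess m B e x over x≤B+e =
  linear 1 (over ⊕ m ⊛ x≤B+e) (solve (m ∷ B ∷ e ∷ x ∷ []))

m*[4*d]≡4*m*d : ∀ m d → m * (4 * d) ≡ 4 * m * d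
m*[4*d]≡4*m*d m d = solve (m ∷ d ∷ [])

-- The first rebalancing costs 2 B ≤ 8 m D and is charged directly to the lower bound `D` on the
-- optimum.
lazy-to-eager : ∀ m q B D S {T R} → T ≤ q * D → R ≤ 2 * B → B ≤ 4 * m * D →
  T + R + 2 * m * 0 ≤ (q + 8 * m) * D + S
lazy-to-eager m q B D S {T} {R} h₁ h₂ h₃ =
  linear S (h₁ ⊕ h₂ ⊕ 2 ⊛ h₃) (solve (m ∷ q ∷ B ∷ D ∷ S ∷ T ∷ R ∷ []))

-- A later rebalancing is paid by the accumulated credit, since 2 B ≤ 2 m e; the excess then
-- restarts at 0.
eager-refund : ∀ m B e T {R} → R ≤ 2 * B → B ≤ m * e → T + R + 2 * m * 0 ≤ T + 2 * m * e
eager-refund m B e T {R} h₁ h₂ = linear 0 (h₁ ⊕ 2 ⊛ h₂) (solve (m ∷ B ∷ e ∷ T ∷ R ∷ []))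

-- 30 absorbs 15 (l + 1) for l ≥ 1, and the first 8 m is the first rebalancing. The product is the
-- factor 2 m + 1 of the eager potential, which itself is at most 2 B l ≤ 8 m d l.
competitiveness : ℕ → ℕ
competitiveness m = 30 + 8 * m + suc (2 * m) * (8 * m)

lazy-competitive : ∀ m {l T d} → 1 ≤ l → T ≤ 15 * suc l * d → T ≤ competitiveness m * l * d
lazy-competitive m {l} {T} {d} 1≤l h = ≤-trans (bound l T d h 1≤l)
  (*-monoˡ-≤ d (*-monoˡ-≤ l (≤-trans (m≤m+n 30 (8 * m)) (m≤m+n (30 + 8 * m) _))))
  where
  bound : ∀ l T d → T ≤ 15 * (1 + l) * d → 1 ≤ l → T ≤ 30 * l * d
  bound l T d h 1≤l = linear 0 (h ⊕ 15 ⊛ (d ⊛ 1≤l)) (solve (l ∷ T ∷ d ∷ []))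

eager-competitive : ∀ m {l T d S} → 1 ≤ l → S ≤ 2 * (4 * m * d) * l →
  T ≤ (15 * suc l + 8 * m) * d + suc (2 * m) * S → T ≤ competitiveness m * l * d
eager-competitive m {l} {T} {d} {S} 1≤l h₁ h₂ =
  bound (8 * m) (suc (2 * m)) l T d S
    (≤-trans h₁ (≤-reflexive (cong (_* l) (regroup m d)))) h₂ 1≤l
  where
  regroup : ∀ m d → 2 * (4 * m * d) ≡ 8 * m * d
  regroup m d = solve (m ∷ d ∷ [])
  bound : ∀ j k l T d S → S ≤ j * d * l → T ≤ (15 * (1 + l) + j) * d + k * S → 1 ≤ l →
    T ≤ (30 + j + k * j) * l * d
  bound j k l T d S h₁ h₂ 1≤l = linear 0 (h₂ ⊕ k ⊛ h₁ ⊕ (15 + j) ⊛ (d ⊛ 1≤l))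
    (solve (j ∷ k ∷ l ∷ T ∷ d ∷ S ∷ []))

open import Algebra.Properties.CommutativeMonoid.Sum using (sum-cong-≗; ∑-distrib-+; ∑-comm)
open import Data.Fin.Base using (Fin; zero; suc; opposite; inject₁)
open import Data.Fin.Patterns using (0F; 1F)
open import Data.Fin.Properties using (_≟_; all?; ¬∀⟶∃¬)
open import Data.Fin.Subset using (Subset)
open import Data.Fin.Subset.Properties using (anySubset?)
open import Data.Integer.Base as ℤ using ()
open import Data.Integer.Properties as ℤ using ()
open import Data.List.Relation.Unary.All as All using (All; []; _∷_)
open import Data.Rational.Base as ℚ using (ℚ; mkℚ; 0ℚ; 1ℚ; ↧ₙ_)
open import Data.Rational.Properties as ℚ using ()
open import Data.Rational.Unnormalised.Base as ℚᵘ using (mkℚᵘ; *≤*)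
open import Data.Rational.Unnormalised.Properties as ℚᵘ using ()
open import Data.Vec.Base using (lookup; tabulate)
open import Data.Vec.Functional using (Vector) renaming (_∷_ to _∷ᶠ_)
open import Data.Vec.Properties using (lookup∘tabulate)
open import Function.Base using (_∘_)
open import Function.Bundles using (Equivalence)
open import Relation.Binary.Definitions using (tri<; tri≈; tri>)
open import Relation.Nullary using (Dec; yes; no; does; contradiction; ¬_)
open import Relation.Nullary.Decidable
  using (dec-true; dec-false; _→-dec_; _×-dec_; ¬?; map′)

-- Finite sums

∑-cong : ∀ {n} {f g : Vector ℕ n} → (∀ i → f i ≡ g i) → ∑ f ≡ ∑ g
∑-cong = sum-cong-≗ +-0-commutativeMonoid

∑-+ : ∀ {n} (f g : Vector ℕ n) → ∑ (λ i → f i + g i) ≡ ∑ f + ∑ g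
∑-+ = ∑-distrib-+ +-0-commutativeMonoid

∑-mono : ∀ {n} {f g : Vector ℕ n} → (∀ i → f i ≤ g i) → ∑ f ≤ ∑ g
∑-mono {zero}  f≤g = z≤n
∑-mono {suc n} f≤g = f≤g zero ⊕ ∑-mono (λ i → f≤g (suc i))

∑-zero : ∀ n → ∑ {n} (λ _ → 0) ≡ 0
∑-zero zero    = refl
∑-zero (suc n) = ∑-zero n

∑-one : ∀ n → ∑ {n} (λ _ → 1) ≡ n
∑-one zero    = refl
∑-one (suc n) = cong suc (∑-one n)

∑-*ˡ : ∀ {n} k (f : Vector ℕ n) → ∑ (λ i → k * f i) ≡ k * ∑ f
∑-*ˡ {zero}  k f = sym (*-zeroʳ k)
∑-*ˡ {suc n} k f = trans (cong (k * f zero +_) (∑-*ˡ k (f ∘ suc))) (sym (*-distribˡ-+ k (f zero) _))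

∑-point : ∀ {n} (r : Fin n) x → ∑ (λ t → if does (r ≟ t) then x else 0) ≡ x
∑-point {suc n} zero    x = trans (cong (x +_) (∑-zero n)) (+-identityʳ x)
∑-point {suc n} (suc r) x = ∑-point r x

∑-bound : ∀ {n} (f : Vector ℕ n) r → f r ≤ ∑ f
∑-bound {suc n} f zero    = m≤m+n _ _
∑-bound {suc n} f (suc r) = ≤-trans (∑-bound (f ∘ suc) r) (m≤n+m _ _)

off : ∀ {n} → Fin n → Vector ℕ n → Vector ℕ n
off r φ t = if does (r ≟ t) then 0 else φ t

∑-off : ∀ {n} (r : Fin n) φ → ∑ φ ≡ ∑ (off r φ) + φ r
∑-off r φ = begin
  ∑ φ                                                       ≡⟨ ∑-cong split ⟩
  ∑ (λ t → off r φ t + (if does (r ≟ t) then φ r else 0))  ≡⟨ ∑-+ (off r φ) _ ⟩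
  ∑ (off r φ) + ∑ (λ t → if does (r ≟ t) then φ r else 0)
    ≡⟨ cong (∑ (off r φ) +_) (∑-point r (φ r)) ⟩
  ∑ (off r φ) + φ r                                         ∎
  where
  open ≡-Reasoning
  split : ∀ t → φ t ≡ off r φ t + (if does (r ≟ t) then φ r else 0)
  split t with r ≟ t
  ... | yes refl = refl
  ... | no _     = sym (+-identityʳ (φ t))

-- Meant for merges: only two labels change, and the amortised inequality holds for these two
-- together but need not hold for each of them.
∑-mono-except : ∀ {n} {r s : Fin n} (φ ψ : Vector ℕ n) → r ≢ s →
  (∀ t → r ≢ t → s ≢ t → φ t ≤ ψ t) → φ r + φ s ≤ ψ r + ψ s → ∑ φ ≤ ∑ ψ
∑-mono-except {_} {r} {s} φ ψ r≢s rest pair = begin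
  ∑ φ                                    ≡⟨ split φ ⟩
  ∑ (off s (off r φ)) + (φ r + φ s)      ≤⟨ ∑-mono rest′ ⊕ pair ⟩
  ∑ (off s (off r ψ)) + (ψ r + ψ s)      ≡⟨ split ψ ⟨
  ∑ ψ                                    ∎
  where
  open ≤-Reasoning
  split : ∀ χ → ∑ χ ≡ ∑ (off s (off r χ)) + (χ r + χ s)
  split χ = begin-equality
    ∑ χ                                      ≡⟨ ∑-off r χ ⟩
    ∑ (off r χ) + χ r                        ≡⟨ cong (_+ χ r) (∑-off s (off r χ)) ⟩
    ∑ (off s (off r χ)) + off r χ s + χ r    ≡⟨ +-assoc (∑ (off s (off r χ))) _ _ ⟩
    ∑ (off s (off r χ)) + (off r χ s + χ r)
      ≡⟨ cong (λ b → ∑ (off s (off r χ)) + ((if b then 0 else χ s) + χ r)) (dec-false (r ≟ s) r≢s) ⟩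
    ∑ (off s (off r χ)) + (χ s + χ r)        ≡⟨ cong (∑ (off s (off r χ)) +_) (+-comm (χ s) (χ r)) ⟩
    ∑ (off s (off r χ)) + (χ r + χ s)        ∎
  rest′ : ∀ t → off s (off r φ) t ≤ off s (off r ψ) t
  rest′ t with s ≟ t
  ... | yes _ = z≤n
  ... | no s≢t with r ≟ t
  ...   | yes _ = z≤n
  ...   | no r≢t = rest t r≢t s≢t

-- Sums over the classes of a labelling

Labelling : ℕ → Set
Labelling n = Fin n → Fin n

within : ∀ {n} → Labelling n → Vector ℕ n → Fin n → Vector ℕ n
within ℓ f t v = if does (ℓ v ≟ t) then f v else 0

part : ∀ {n} → Labelling n → Vector ℕ n → Vector ℕ n
part ℓ f t = ∑ (within ℓ f t)

-- Labels are themselves vertices, and for distinct `r` and `s` the label `s` becomes empty. Sums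
-- over components can thus range over all of `Fin n`, with empty labels contributing nothing.
merge : ∀ {n} → Labelling n → Fin n → Fin n → Labelling n
merge ℓ r s v = if does (ℓ v ≟ s) then r else ℓ v

module _ {n} (ℓ : Labelling n) where

  part-cong : ∀ {f g} t → (∀ v → ℓ v ≡ t → f v ≡ g v) → part ℓ f t ≡ part ℓ g t
  part-cong {f} {g} t eq = ∑-cong pointwise
    where
    pointwise : ∀ v → within ℓ f t v ≡ within ℓ g t v
    pointwise v with ℓ v ≟ t
    ... | yes p = eq v p
    ... | no _  = refl

  part-+ : ∀ f g t → part ℓ (λ v → f v + g v) t ≡ part ℓ f t + part ℓ g t
  part-+ f g t = trans (∑-cong pointwise) (∑-+ (within ℓ f t) (within ℓ g t))
    where
    pointwise : ∀ v → within ℓ (λ u → f u + g u) t v ≡ within ℓ f t v + within ℓ g t v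
    pointwise v with does (ℓ v ≟ t)
    ... | true  = refl
    ... | false = refl

  part≤∑ : ∀ f t → part ℓ f t ≤ ∑ f
  part≤∑ f t = ∑-mono pointwise
    where
    pointwise : ∀ v → within ℓ f t v ≤ f v
    pointwise v with does (ℓ v ≟ t)
    ... | true  = ≤-refl
    ... | false = z≤n

  part-zero : ∀ {f} t → (∀ v → ℓ v ≡ t → f v ≡ 0) → part ℓ f t ≡ 0
  part-zero t eq = trans (part-cong t eq) (trans (∑-cong zero-everywhere) (∑-zero n))
    where
    zero-everywhere : ∀ v → within ℓ (λ _ → 0) t v ≡ 0
    zero-everywhere v with does (ℓ v ≟ t)
    ... | true  = refl
    ... | false = refl

  part-pos : ∀ v → 0 < part ℓ (λ _ → 1) (ℓ v)
  part-pos v = begin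
    1
      ≡⟨ cong (λ b → if b then 1 else 0) (dec-true (ℓ v ≟ ℓ v) refl) ⟨
    within ℓ (λ _ → 1) (ℓ v) v
      ≤⟨ ∑-bound (within ℓ (λ _ → 1) (ℓ v)) v ⟩
    part ℓ (λ _ → 1) (ℓ v) ∎
    where open ≤-Reasoning

  ∑-part : ∀ f → ∑ (part ℓ f) ≡ ∑ f
  ∑-part f = trans (∑-comm +-0-commutativeMonoid (within ℓ f))
    (∑-cong (λ v → ∑-point (ℓ v) (f v)))

  module _ {r s : Fin n} (r≢s : r ≢ s) (f : Vector ℕ n) where

    part-merge-into : part (merge ℓ r s) f r ≡ part ℓ f r + part ℓ f s
    part-merge-into = trans (∑-cong pointwise) (∑-+ (within ℓ f r) (within ℓ f s))
      where
      pointwise : ∀ v → within (merge ℓ r s) f r v ≡ within ℓ f r v + within ℓ f s v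
      pointwise v with ℓ v ≟ s
      ... | yes refl rewrite dec-true (r ≟ r) refl | dec-false (ℓ v ≟ r) (r≢s ∘ sym) = refl
      ... | no _ = sym (+-identityʳ _)

    part-merge-from : part (merge ℓ r s) f s ≡ 0
    part-merge-from = trans (∑-cong pointwise) (∑-zero n)
      where
      pointwise : ∀ v → within (merge ℓ r s) f s v ≡ 0
      pointwise v with ℓ v ≟ s
      ... | yes refl rewrite dec-false (r ≟ ℓ v) r≢s = refl
      ... | no ℓv≢s rewrite dec-false (ℓ v ≟ s) ℓv≢s = refl

    part-merge-other : ∀ t → r ≢ t → s ≢ t → part (merge ℓ r s) f t ≡ part ℓ f t
    part-merge-other t r≢t s≢t = ∑-cong pointwise
      where
      pointwise : ∀ v → within (merge ℓ r s) f t v ≡ within ℓ f t v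
      pointwise v with ℓ v ≟ s
      ... | yes refl rewrite dec-false (r ≟ t) r≢t | dec-false (ℓ v ≟ t) s≢t = refl
      ... | no _ = refl

-- Two-colorings and the components of a graph

opposite-mismatch : ∀ (i j : Color) x →
  (if does (i ≟ opposite j) then 0 else x) ≡ (if does (i ≟ j) then x else 0)
opposite-mismatch 0F 0F x = refl
opposite-mismatch 0F 1F x = refl
opposite-mismatch 1F 0F x = refl
opposite-mismatch 1F 1F x = refl

opposite-match : ∀ (i j : Color) x →
  (if does (i ≟ opposite j) then x else 0) ≡ (if does (i ≟ j) then 0 else x)
opposite-match 0F 0F x = refl
opposite-match 0F 1F x = refl
opposite-match 1F 0F x = refl
opposite-match 1F 1F x = refl

opposite-injective : ∀ {i j : Color} → opposite i ≡ opposite j → i ≡ j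
opposite-injective {0F} {0F} _ = refl
opposite-injective {0F} {1F} ()
opposite-injective {1F} {0F} ()
opposite-injective {1F} {1F} _ = refl

flipIf : Bool → Color → Color
flipIf x i = if x then opposite i else i

flipIf-≢ : ∀ x {i j : Color} → i ≢ j → flipIf x i ≢ flipIf x j
flipIf-≢ true  i≢j = i≢j ∘ opposite-injective
flipIf-≢ false i≢j = i≢j

flipIf-separates : ∀ x (i j : Color) → flipIf x i ≢ flipIf (x xor does (i ≟ j)) j
flipIf-separates true  0F 0F ()
flipIf-separates true  0F 1F ()
flipIf-separates true  1F 0F ()
flipIf-separates true  1F 1F ()
flipIf-separates false 0F 0F ()
flipIf-separates false 0F 1F ()
flipIf-separates false 1F 0F ()
flipIf-separates false 1F 1F ()

-- Crossing an edge switches to the other of the two colors in both colorings, so agreement at one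
-- end is agreement at the other.
agreement-across : ∀ {i i′ j j′ : Color} → i ≢ j → i′ ≢ j′ → does (i ≟ i′) ≡ does (j ≟ j′)
agreement-across {0F} {_}  {0F} p _ = contradiction refl p
agreement-across {1F} {_}  {1F} p _ = contradiction refl p
agreement-across {0F} {0F} {1F} {0F} p q = contradiction refl q
agreement-across {0F} {0F} {1F} {1F} p q = refl
agreement-across {0F} {1F} {1F} {0F} p q = refl
agreement-across {0F} {1F} {1F} {1F} p q = contradiction refl q
agreement-across {1F} {0F} {0F} {0F} p q = contradiction refl q
agreement-across {1F} {0F} {0F} {1F} p q = refl
agreement-across {1F} {1F} {0F} {0F} p q = refl
agreement-across {1F} {1F} {0F} {1F} p q = contradiction refl q

≢-transport : ∀ {i i′ j j′ : Color} → does (i ≟ i′) ≡ does (j ≟ j′) → i′ ≢ j′ → i ≢ j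
≢-transport {i} {i′} {j} {j′} same i′≢j′ refl with i ≟ i′ | i ≟ j′
... | yes refl | yes refl = i′≢j′ refl
... | no p | no q = i′≢j′ (two-colors p q)
  where
  two-colors : ∀ {i j k : Color} → i ≢ j → i ≢ k → j ≡ k
  two-colors {0F} {0F} p _ = contradiction refl p
  two-colors {0F} {1F} {0F} _ q = contradiction refl q
  two-colors {0F} {1F} {1F} _ _ = refl
  two-colors {1F} {1F} p _ = contradiction refl p
  two-colors {1F} {0F} {0F} _ _ = refl
  two-colors {1F} {0F} {1F} _ q = contradiction refl q

-- Connectivity is encoded without paths, by its effect on 2-colorings: two proper colorings agree
-- on all of a component or on none of it.
record Components {n} (es : List (Edge n)) (ℓ : Labelling n) : Set where
  field
    closed : All (λ (u , v) → ℓ u ≡ ℓ v) es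
    rigid  : ∀ {c c′} → Proper es c → Proper es c′ →
             ∀ {x y} → ℓ x ≡ ℓ y → does (c x ≟ c′ x) ≡ does (c y ≟ c′ y)

open Components

merge-≡ : ∀ {n} (ℓ : Labelling n) r s {x y} → ℓ x ≡ ℓ y → merge ℓ r s x ≡ merge ℓ r s y
merge-≡ ℓ r s eq = cong (λ t → if does (t ≟ s) then r else t) eq

Components-merge : ∀ {n} {es : List (Edge n)} {ℓ u v} → ℓ u ≢ ℓ v →
  Components es ℓ → Components ((u , v) ∷ es) (merge ℓ (ℓ u) (ℓ v))
Components-merge {n} {es} {ℓ} {u} {v} ℓu≢ℓv K = record
  { closed = joined ∷ All.map (λ {e} → merge-≡ ℓ (ℓ u) (ℓ v)) (closed K)
  ; rigid  = rigid′
  }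
  where
  joined : merge ℓ (ℓ u) (ℓ v) u ≡ merge ℓ (ℓ u) (ℓ v) v
  joined rewrite dec-false (ℓ u ≟ ℓ v) ℓu≢ℓv | dec-true (ℓ v ≟ ℓ v) refl = refl
  rigid′ : ∀ {c c′} → Proper ((u , v) ∷ es) c → Proper ((u , v) ∷ es) c′ →
    ∀ {x y} → merge ℓ (ℓ u) (ℓ v) x ≡ merge ℓ (ℓ u) (ℓ v) y → does (c x ≟ c′ x) ≡ does (c y ≟ c′ y)
  rigid′ {c} {c′} (cu≢cv ∷ p) (c′u≢c′v ∷ p′) {x} {y} eq with ℓ x ≟ ℓ v | ℓ y ≟ ℓ v
  ... | yes x~v | yes y~v = rigid K p p′ (trans x~v (sym y~v))
  -- Agreement travels from `x` to `v`, across the new edge to `u`, and on to `y`.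
  ... | yes x~v | no _    = trans (rigid K p p′ x~v)
                              (trans (sym (agreement-across cu≢cv c′u≢c′v)) (rigid K p p′ eq))
  ... | no _    | yes y~v = trans (rigid K p p′ eq)
                              (trans (agreement-across cu≢cv c′u≢c′v) (rigid K p p′ (sym y~v)))
  ... | no _    | no _    = rigid K p p′ eq

Components-∷ : ∀ {n} {es : List (Edge n)} {ℓ u v} → ℓ u ≡ ℓ v →
  Components es ℓ → Components ((u , v) ∷ es) ℓ
Components-∷ eq K = record
  { closed = eq ∷ closed K
  ; rigid  = λ { (_ ∷ p) (_ ∷ p′) → rigid K p p′ }
  }

Components-[] : ∀ {n} → Components {n} [] (λ v → v)
Components-[] = record { closed = [] ; rigid = λ { _ _ refl → refl } }

module _ {n} (ℓ : Labelling n) where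

  flipBy : (Fin n → Bool) → Coloring n → Coloring n
  flipBy β c v = flipIf (β (ℓ v)) (c v)

  flipBy-proper : ∀ {es} β {c} → All (λ (u , v) → ℓ u ≡ ℓ v) es → Proper es c →
    Proper es (flipBy β c)
  flipBy-proper β [] [] = []
  flipBy-proper β {c} (_∷_ {x = (u , v)} eq eqs) (p ∷ ps) =
    subst (λ t → flipIf (β (ℓ u)) (c u) ≢ flipIf (β t) (c v)) eq (flipIf-≢ (β (ℓ u)) p)
      ∷ flipBy-proper β eqs ps

mask : ∀ {n} → Fin n → Bool → Fin n → Bool → Fin n → Bool
mask r x s y t = if does (r ≟ t) then x else if does (s ≟ t) then y else false

module _ {n} {r s : Fin n} (r≢s : r ≢ s) (x y : Bool) where

  mask-first : mask r x s y r ≡ x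
  mask-first rewrite dec-true (r ≟ r) refl = refl

  mask-second : mask r x s y s ≡ y
  mask-second rewrite dec-false (r ≟ s) r≢s | dec-true (s ≟ s) refl = refl

  mask-other : ∀ t → r ≢ t → s ≢ t → mask r x s y t ≡ false
  mask-other t r≢t s≢t rewrite dec-false (r ≟ t) r≢t | dec-false (s ≟ t) s≢t = refl

-- Recolored weight and recoloring cost

module _ {n} (w : Weights n) where

  differing agreeing : Coloring n → Coloring n → Vector ℕ n
  differing c c′ v = if does (c v ≟ c′ v) then 0 else w v
  agreeing c c′ v = if does (c v ≟ c′ v) then w v else 0

  differing-refl : ∀ c v → differing c c v ≡ 0
  differing-refl c v rewrite dec-true (c v ≟ c v) refl = refl

  recoloringCost-triangle : ∀ c c′ c″ →
    recoloringCost w c c″ ≤ recoloringCost w c c′ + recoloringCost w c′ c″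
  recoloringCost-triangle c c′ c″ =
    ≤-trans (∑-mono pointwise) (≤-reflexive (∑-+ (differing c c′) (differing c′ c″)))
    where
    pointwise : ∀ v → differing c c″ v ≤ differing c c′ v + differing c′ c″ v
    pointwise v with c v ≟ c′ v | c′ v ≟ c″ v | c v ≟ c″ v
    ... | _      | _      | yes _ = z≤n
    ... | yes p  | yes q  | no r  = contradiction (trans p q) r
    ... | no _   | _      | no _  = m≤m+n _ _
    ... | yes _  | no _   | no _  = ≤-refl

  recoloringCost≤∑ : ∀ c c′ → recoloringCost w c c′ ≤ ∑ w
  recoloringCost≤∑ c c′ = ∑-mono pointwise
    where
    pointwise : ∀ v → differing c c′ v ≤ w v
    pointwise v with does (c v ≟ c′ v)
    ... | true  = z≤n
    ... | false = ≤-refl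

  classWeight-recolor : ∀ c c′ i → classWeight w c′ i ≤ classWeight w c i + recoloringCost w c c′
  classWeight-recolor c c′ i =
    ≤-trans (∑-mono pointwise)
      (≤-reflexive (∑-+ (λ v → if does (c v ≟ i) then w v else 0) (differing c c′)))
    where
    pointwise : ∀ v → (if does (c′ v ≟ i) then w v else 0)
              ≤ (if does (c v ≟ i) then w v else 0) + differing c c′ v
    pointwise v with c′ v ≟ i | c v ≟ i | c v ≟ c′ v
    ... | no _  | _     | _     = z≤n
    ... | yes _ | yes _ | _     = m≤m+n _ _
    ... | yes _ | no _  | no _  = ≤-refl
    ... | yes p | no q  | yes r = contradiction (trans r p) q

  module _ (ℓ : Labelling n) where

    part-split : ∀ c c′ t → part ℓ w t ≡ part ℓ (differing c c′) t + part ℓ (agreeing c c′) t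
    part-split c c′ t = trans (part-cong ℓ t (λ v _ → pointwise v))
      (part-+ ℓ (differing c c′) (agreeing c c′) t)
      where
      pointwise : ∀ v → w v ≡ differing c c′ v + agreeing c c′ v
      pointwise v with does (c v ≟ c′ v)
      ... | true  = refl
      ... | false = sym (+-identityʳ (w v))

    module _ (β : Fin n → Bool) (c : Coloring n) where

      part-differing-flip : ∀ c₀ t → part ℓ (differing c₀ (flipBy ℓ β c)) t
        ≡ swapIf (β t) (part ℓ (differing c₀ c) t) (part ℓ (agreeing c₀ c) t)
      part-differing-flip c₀ t with β t in eq
      ... | true  = part-cong ℓ t λ { v refl → trans
                      (cong (λ x → if does (c₀ v ≟ flipIf x (c v)) then 0 else w v) eq)
                      (opposite-mismatch (c₀ v) (c v) (w v)) }
      ... | false = part-cong ℓ t λ { v refl →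
                      cong (λ x → if does (c₀ v ≟ flipIf x (c v)) then 0 else w v) eq }

      part-agreeing-flip : ∀ c₀ t → part ℓ (agreeing c₀ (flipBy ℓ β c)) t
        ≡ swapIf (β t) (part ℓ (agreeing c₀ c) t) (part ℓ (differing c₀ c) t)
      part-agreeing-flip c₀ t with β t in eq
      ... | true  = part-cong ℓ t λ { v refl → trans
                      (cong (λ x → if does (c₀ v ≟ flipIf x (c v)) then w v else 0) eq)
                      (opposite-match (c₀ v) (c v) (w v)) }
      ... | false = part-cong ℓ t λ { v refl →
                      cong (λ x → if does (c₀ v ≟ flipIf x (c v)) then w v else 0) eq }

      recoloringCost-flip :
        recoloringCost w c (flipBy ℓ β c) ≡ ∑ (λ t → flipCost (β t) (part ℓ w t))
      recoloringCost-flip = trans (sym (∑-part ℓ (differing c (flipBy ℓ β c)))) (∑-cong pointwise)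
        where
        pointwise : ∀ t → part ℓ (differing c (flipBy ℓ β c)) t ≡ flipCost (β t) (part ℓ w t)
        pointwise t with β t in eq
        ... | true  = part-cong ℓ t λ { v refl → trans
                        (cong (λ x → if does (c v ≟ flipIf x (c v)) then 0 else w v) eq)
                        (trans (opposite-mismatch (c v) (c v) (w v))
                          (cong (λ b → if b then w v else 0) (dec-true (c v ≟ c v) refl))) }
        ... | false = part-zero ℓ t λ { v refl → trans
                        (cong (λ x → if does (c v ≟ flipIf x (c v)) then 0 else w v) eq)
                        (differing-refl c v) }

    -- On a component every proper coloring is c or its opposite.
    recoloringCost-lower : ∀ {es} c₀ c → Components es ℓ → Proper es c → ∀ c′ → Proper es c′ →
      ∑ (λ t → part ℓ (differing c₀ c) t ⊓ part ℓ (agreeing c₀ c) t) ≤ recoloringCost w c₀ c′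
    recoloringCost-lower {es} c₀ c K proper c′ proper′ =
      ≤-trans (∑-mono component) (≤-reflexive (∑-part ℓ (differing c₀ c′)))
      where
      component : ∀ t →
        part ℓ (differing c₀ c) t ⊓ part ℓ (agreeing c₀ c) t ≤ part ℓ (differing c₀ c′) t
      component t with all? (λ v → (ℓ v ≟ t) →-dec (c v ≟ c′ v))
      ... | yes same = ≤-trans (m⊓n≤m _ _) (≤-reflexive (part-cong ℓ t λ v v∈t →
              cong (λ i → if does (c₀ v ≟ i) then 0 else w v) (same v v∈t)))
      -- By rigidity one disagreement spreads over the whole component, so there `c′` is the
      -- opposite of `c` and differs from c₀ exactly where `c` agrees with it.
      ... | no ¬same = ≤-trans (m⊓n≤n (part ℓ (differing c₀ c) t) _)
              (≤-reflexive (part-cong ℓ t λ v v∈t → disagree v v∈t (c v ≟ c′ v)))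
        where
        witness : ∃[ x ] ¬ (ℓ x ≡ t → c x ≡ c′ x)
        witness = ¬∀⟶∃¬ n _ (λ v → (ℓ v ≟ t) →-dec (c v ≟ c′ v)) ¬same
        disagree : ∀ v → ℓ v ≡ t → Dec (c v ≡ c′ v) → agreeing c₀ c v ≡ differing c₀ c′ v
        disagree v v∈t (yes cv≡c′v) = contradiction agree (proj₂ witness)
          where
          x = proj₁ witness
          agree : ℓ x ≡ t → c x ≡ c′ x
          agree x∈t with c x ≟ c′ x | rigid K proper proper′ {v} {x} (trans v∈t (sym x∈t))
          ... | yes p | _ = p
          ... | no _  | e = contradiction (trans (sym (dec-true (c v ≟ c′ v) cv≡c′v)) e) λ ()
        disagree v v∈t (no cv≢c′v) = opposed (c₀ v) (c v) (c′ v) cv≢c′v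
          where
          opposed : ∀ (i j k : Color) → j ≢ k →
            (if does (i ≟ j) then w v else 0) ≡ (if does (i ≟ k) then 0 else w v)
          opposed i 0F 0F p = contradiction refl p
          opposed i 1F 1F p = contradiction refl p
          opposed 0F 0F 1F p = refl
          opposed 0F 1F 0F p = refl
          opposed 1F 0F 1F p = refl
          opposed 1F 1F 0F p = refl

-- Searching for a balanced coloring

module _ {n} (w : Weights n) (es : List (Edge n)) where

  Balanced : Coloring n → Set
  Balanced c = Proper es c × Respects w (exactly (half w)) c

  Balanced-≗ : ∀ {c c′} → c ≗ c′ → Balanced c → Balanced c′
  Balanced-≗ eq (proper , respects) =
    All.map (λ {e} → subst₂ _≢_ (eq (proj₁ e)) (eq (proj₂ e))) proper ,
    λ i → subst (_≤ half w)
      (∑-cong (λ v → cong (λ j → if does (j ≟ i) then w v else 0) (eq v))) (respects i)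

  -- Exhaustive search, a coloring being coded by the subset of its vertices of color `0F`. Decoding
  -- returns it only up to pointwise equality, hence `Balanced-≗`.
  balanced? : Dec (∃[ c ] Balanced c)
  balanced? = map′ (λ (S , bal) → fromSubset S , bal)
    (λ (c , bal) → tabulate (λ v → does (c v ≟ 0F)) , Balanced-≗ (toFrom c) bal)
    (anySubset? λ S → All.all? (λ (u , v) → ¬? (fromSubset S u ≟ fromSubset S v)) es
                      ×-dec all? (λ i → classWeight w (fromSubset S) i ≤? half w))
    where
    fromSubset : Subset n → Coloring n
    fromSubset S v = if lookup S v then 0F else 1F
    toFrom : ∀ (c : Coloring n) v → c v ≡ fromSubset (tabulate (λ u → does (c u ≟ 0F))) v
    toFrom c v rewrite lookup∘tabulate (λ u → does (c u ≟ 0F)) v with c v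
    ... | 0F = refl
    ... | 1F = refl

-- Costs of schedules

module _ {n} (w : Weights n) where

  cost-∷ : ∀ c {e σ} (s : Schedule (e ∷ σ)) →
    cost w c (e ∷ σ) s ≡ recoloringCost w c (s 0F) + cost w (s 0F) σ (s ∘ suc)
  cost-∷ c {e} {σ} s = cong (recoloringCost w c (s 0F) +_)
    (∑-cong (λ t → cong (λ d → recoloringCost w d (s (suc t))) (uncons (inject₁ t))))
    where
    uncons : ∀ i → s i ≡ (s 0F ∷ᶠ (s ∘ suc)) i
    uncons 0F      = refl
    uncons (suc i) = refl

  final : Coloring n → (σ : List (Edge n)) → Schedule σ → Coloring n
  final c []      s = c
  final c (e ∷ σ) s = final (s 0F) σ (s ∘ suc)

  -- By the triangle inequality. Applied to an optimal schedule, it bounds the optimum below by the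
  -- distance from c₀ to a proper coloring.
  recoloringCost-final : ∀ c σ s → recoloringCost w c (final c σ s) ≤ cost w c σ s
  recoloringCost-final c [] s =
    ≤-reflexive (trans (∑-cong (differing-refl w c)) (∑-zero n))
  recoloringCost-final c (e ∷ σ) s = begin
    recoloringCost w c (final (s 0F) σ (s ∘ suc))
      ≤⟨ recoloringCost-triangle w c (s 0F) _ ⟩
    recoloringCost w c (s 0F) + recoloringCost w (s 0F) (final (s 0F) σ (s ∘ suc))
      ≤⟨ +-monoʳ-≤ _ (recoloringCost-final (s 0F) σ (s ∘ suc)) ⟩
    recoloringCost w c (s 0F) + cost w (s 0F) σ (s ∘ suc)
      ≡⟨ cost-∷ c {e} {σ} s ⟨
    cost w c (e ∷ σ) s ∎
    where open ≤-Reasoning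

  -- Prefixes of the tail forget the first request. The predicate `P` carries it through the
  -- induction, collecting the edges that all remaining colorings respect.
  final-proper : (P : Coloring n → Set) → ∀ c σ s → P c → (∀ t → P (s t)) →
    (∀ t → Proper (prefix σ t) (s t)) → P (final c σ s) × Proper σ (final c σ s)
  final-proper P c []      s Pc Ps proper = Pc , []
  final-proper P c (e ∷ σ) s Pc Ps proper =
    let ((Pf , ef) , pf) = final-proper (λ d → P d × Proper (e ∷ []) d) (s 0F) σ (s ∘ suc)
          (Ps 0F , proper 0F)
          (λ t → Ps (suc t) , All.head (proper (suc t)) ∷ [])
          (λ t → All.tail (proper (suc t)))
    in Pf , All.head ef ∷ pf

-- The online algorithm

data Mode : Set where
  lazy eager : Mode

record State (n : ℕ) : Set where
  constructor state
  field
    mode : Mode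
    seen : List (Edge n)
    labels : Labelling n
    current : Coloring n

open State

module Algorithm {n} (w : Weights n) (m : ℕ) (c₀ : Coloring n) where

  B = half w
  L = ⌊log₂ n ⌋

  -- Capacity (1 + 1/m) B with the fraction cleared, so that it is decidable on natural numbers.
  Fits : Coloring n → Set
  Fits c = ∀ i → m * classWeight w c i ≤ suc m * B

  fits? : ∀ c → Dec (Fits c)
  fits? c = all? (λ i → m * classWeight w c i ≤? suc m * B)

  size weight : Labelling n → Fin n → ℕ
  size ℓ = part ℓ (λ _ → 1)
  weight ℓ = part ℓ w

  moved kept : Labelling n → Coloring n → Fin n → ℕ
  moved ℓ c = part ℓ (differing w c₀ c)
  kept ℓ c = part ℓ (agreeing w c₀ c)

  lazy-flip : ∀ ℓ c u v → ∃[ x ] Pays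
    (moved ℓ c (ℓ u)) (kept ℓ c (ℓ u)) (level (size ℓ (ℓ u)))
    (moved ℓ c (ℓ v)) (kept ℓ c (ℓ v)) (level (size ℓ (ℓ v)))
    (level (size ℓ (ℓ u) + size ℓ (ℓ v))) x (x xor does (c u ≟ c v))
  lazy-flip ℓ c u v = lazyChoice _ _ _ _ _ _ _ (part-pos ℓ u) (part-pos ℓ v)

  eager-flip : ∀ ℓ (c : Coloring n) u v → ∃[ x ]
    flipCost x (weight ℓ (ℓ u)) + flipCost (x xor does (c u ≟ c v)) (weight ℓ (ℓ v))
      + (weight ℓ (ℓ u) * ⌊log₂ size ℓ (ℓ u) ⌋ + weight ℓ (ℓ v) * ⌊log₂ size ℓ (ℓ v) ⌋)
    ≤ (weight ℓ (ℓ u) + weight ℓ (ℓ v)) * ⌊log₂ (size ℓ (ℓ u) + size ℓ (ℓ v)) ⌋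
  eager-flip ℓ c u v = eagerChoice _ _ _ _ _ (part-pos ℓ u) (part-pos ℓ v)

  flip? : Mode → Labelling n → Coloring n → Fin n → Fin n → Bool
  flip? lazy  ℓ c u v = proj₁ (lazy-flip ℓ c u v)
  flip? eager ℓ c u v = proj₁ (eager-flip ℓ c u v)

  reconcile : Mode → Labelling n → Coloring n → Fin n → Fin n → Coloring n
  reconcile μ ℓ c u v = flipBy ℓ (mask (ℓ u) x (ℓ v) (x xor does (c u ≟ c v))) c
    where x = flip? μ ℓ c u v

  -- The last clause is never reached on admissible request sequences.
  settle : Mode → List (Edge n) → Coloring n → Mode × Coloring n
  settle μ es c with fits? c | balanced? w es
  ... | yes _ | _            = μ , c
  ... | no _  | yes (c′ , _) = eager , c′
  ... | no _  | no _         = eager , c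

  step : State n → Edge n → State n
  step (state μ es ℓ c) (u , v) with ℓ u ≟ ℓ v
  ... | yes _ = state μ ((u , v) ∷ es) ℓ c
  ... | no _  = state (proj₁ next) ((u , v) ∷ es) (merge ℓ (ℓ u) (ℓ v)) (proj₂ next)
    where next = settle μ ((u , v) ∷ es) (reconcile μ ℓ c u v)

  start : State n
  start = state lazy [] (λ v → v) c₀

  -- Potentials and ledgers

  Φ : Labelling n → Coloring n → Fin n → ℕ
  Φ ℓ c t = potential (moved ℓ c t) (kept ℓ c t) (level (size ℓ t))

  -- The small-to-large potential: it depends on the components only, not on the coloring, so a
  -- rebalancing leaves it unchanged.
  Ψ : Labelling n → Fin n → ℕ
  Ψ ℓ t = weight ℓ t * ⌊log₂ size ℓ t ⌋

  Φ-cong : ∀ {ℓ ℓ′ c c′ t} → moved ℓ c t ≡ moved ℓ′ c′ t → kept ℓ c t ≡ kept ℓ′ c′ t →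
    size ℓ t ≡ size ℓ′ t → Φ ℓ c t ≡ Φ ℓ′ c′ t
  Φ-cong {ℓ} {ℓ′} {c} {c′} {t} p q r = trans
    (cong₂ (λ i j → potential i j (level (size ℓ t))) p q)
    (cong (λ k → potential (moved ℓ′ c′ t) (kept ℓ′ c′ t) (level k)) r)

  -- T is the cost so far; 2 ∑ moved is credit for flips back towards c₀.
  record LazyLedger (ℓ : Labelling n) (c : Coloring n) (T : ℕ) : Set where
    field
      near    : ∀ t → moved ℓ c t ≤ 4 * kept ℓ c t
      account : T + 2 * ∑ (moved ℓ c) ≤ ∑ (Φ ℓ c)

  -- A flip raises excess by at most its cost, so the credit 2 m · excess has
  -- grown to the cost 2 B of a rebalancing once excess > B / m.
  record EagerLedger (es : List (Edge n)) (ℓ : Labelling n) (c : Coloring n) (T : ℕ) : Set where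
    field
      bound excess : ℕ
      lower   : ∀ c′ → Proper es c′ → bound ≤ recoloringCost w c₀ c′
      large   : B ≤ 4 * m * bound
      loads   : ∀ i → classWeight w c i ≤ B + excess
      account : T + 2 * m * excess ≤ (15 * suc L + 8 * m) * bound + suc (2 * m) * ∑ (Ψ ℓ)

  Ledger : Mode → List (Edge n) → Labelling n → Coloring n → ℕ → Set
  Ledger lazy  es ℓ c T = LazyLedger ℓ c T
  Ledger eager es ℓ c T = EagerLedger es ℓ c T

  Ledger-antitone : ∀ μ {es ℓ c T T′} → T′ ≤ T → Ledger μ es ℓ c T → Ledger μ es ℓ c T′
  Ledger-antitone lazy T′≤T K = record
    { LazyLedger K ; account = ≤-trans (+-monoˡ-≤ _ T′≤T) (LazyLedger.account K) }
  Ledger-antitone eager T′≤T K = record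
    { EagerLedger K ; account = ≤-trans (+-monoˡ-≤ _ T′≤T) (EagerLedger.account K) }

  -- A further edge only removes proper colorings, so a lower bound over all of them persists.
  Ledger-∷ : ∀ μ {e es ℓ c T} → Ledger μ es ℓ c T → Ledger μ (e ∷ es) ℓ c T
  Ledger-∷ lazy  K = K
  Ledger-∷ eager K = record
    { EagerLedger K ; lower = λ { c′ (_ ∷ p) → EagerLedger.lower K c′ p } }

  -- Amortised cost of one merge

  module Merge (ℓ : Labelling n) (c : Coloring n) {r s : Fin n} (r≢s : r ≢ s) (x y : Bool) where

    β : Fin n → Bool
    β = mask r x s y

    ℓ′ : Labelling n
    ℓ′ = merge ℓ r s

    c′ : Coloring n
    c′ = flipBy ℓ β c

    X : Fin n → ℕ
    X t = flipCost (β t) (weight ℓ t)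

    X-first : X r ≡ flipCost x (weight ℓ r)
    X-first = cong (λ b → flipCost b (weight ℓ r)) (mask-first r≢s x y)

    X-second : X s ≡ flipCost y (weight ℓ s)
    X-second = cong (λ b → flipCost b (weight ℓ s)) (mask-second r≢s x y)

    X-other : ∀ t → r ≢ t → s ≢ t → X t ≡ 0
    X-other t r≢t s≢t = cong (λ b → flipCost b (weight ℓ t)) (mask-other r≢s x y t r≢t s≢t)

    moved-into : moved ℓ′ c′ r
      ≡ swapIf x (moved ℓ c r) (kept ℓ c r) + swapIf y (moved ℓ c s) (kept ℓ c s)
    moved-into = trans (part-merge-into ℓ r≢s (differing w c₀ c′))
      (cong₂ _+_
        (trans (part-differing-flip w ℓ β c c₀ r)
          (cong (λ b → swapIf b (moved ℓ c r) (kept ℓ c r)) (mask-first r≢s x y)))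
        (trans (part-differing-flip w ℓ β c c₀ s)
          (cong (λ b → swapIf b (moved ℓ c s) (kept ℓ c s)) (mask-second r≢s x y))))

    kept-into : kept ℓ′ c′ r
      ≡ swapIf x (kept ℓ c r) (moved ℓ c r) + swapIf y (kept ℓ c s) (moved ℓ c s)
    kept-into = trans (part-merge-into ℓ r≢s (agreeing w c₀ c′))
      (cong₂ _+_
        (trans (part-agreeing-flip w ℓ β c c₀ r)
          (cong (λ b → swapIf b (kept ℓ c r) (moved ℓ c r)) (mask-first r≢s x y)))
        (trans (part-agreeing-flip w ℓ β c c₀ s)
          (cong (λ b → swapIf b (kept ℓ c s) (moved ℓ c s)) (mask-second r≢s x y))))

    moved-other : ∀ t → r ≢ t → s ≢ t → moved ℓ′ c′ t ≡ moved ℓ c t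
    moved-other t r≢t s≢t = trans (part-merge-other ℓ r≢s (differing w c₀ c′) t r≢t s≢t)
      (trans (part-differing-flip w ℓ β c c₀ t)
        (cong (λ b → swapIf b (moved ℓ c t) (kept ℓ c t)) (mask-other r≢s x y t r≢t s≢t)))

    kept-other : ∀ t → r ≢ t → s ≢ t → kept ℓ′ c′ t ≡ kept ℓ c t
    kept-other t r≢t s≢t = trans (part-merge-other ℓ r≢s (agreeing w c₀ c′) t r≢t s≢t)
      (trans (part-agreeing-flip w ℓ β c c₀ t)
        (cong (λ b → swapIf b (kept ℓ c t) (moved ℓ c t)) (mask-other r≢s x y t r≢t s≢t)))

    size-into : size ℓ′ r ≡ size ℓ r + size ℓ s
    size-into = part-merge-into ℓ r≢s (λ _ → 1)

    size-other : ∀ t → r ≢ t → s ≢ t → size ℓ′ t ≡ size ℓ t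
    size-other = part-merge-other ℓ r≢s (λ _ → 1)

    lazy-merge : ∀ {T} →
      Pays (moved ℓ c r) (kept ℓ c r) (level (size ℓ r))
           (moved ℓ c s) (kept ℓ c s) (level (size ℓ s)) (level (size ℓ r + size ℓ s)) x y →
      LazyLedger ℓ c T → LazyLedger ℓ′ c′ (T + recoloringCost w c c′)
    lazy-merge {T} (near′ , pays) K = record { near = near-all ; account = account′ }
      where
      open LazyLedger K
      near-all : ∀ t → moved ℓ′ c′ t ≤ 4 * kept ℓ′ c′ t
      near-all t with r ≟ t | s ≟ t
      ... | yes refl | _ = subst₂ (λ i j → i ≤ 4 * j) (sym moved-into) (sym kept-into) near′
      ... | no _ | yes refl = subst (_≤ 4 * kept ℓ′ c′ s)
              (sym (part-merge-from ℓ r≢s (differing w c₀ c′))) z≤n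
      ... | no r≢t | no s≢t = subst₂ (λ i j → i ≤ 4 * j)
              (sym (moved-other t r≢t s≢t)) (sym (kept-other t r≢t s≢t)) (near t)

      -- The two sides of the amortised inequality label by label. To avoid subtraction, the new
      -- credit and old potential stand on the left, the old credit and new potential on the right.
      φ ψ : Fin n → ℕ
      φ t = X t + 2 * moved ℓ′ c′ t + Φ ℓ c t
      ψ t = 2 * moved ℓ c t + Φ ℓ′ c′ t

      others : ∀ t → r ≢ t → s ≢ t → φ t ≤ ψ t
      others t r≢t s≢t = ≤-reflexive (cong₂ _+_
        (cong₂ (λ i j → i + 2 * j) (X-other t r≢t s≢t) (moved-other t r≢t s≢t))
        (sym (Φ-cong {ℓ′} {ℓ} {c′} {c} {t}
          (moved-other t r≢t s≢t) (kept-other t r≢t s≢t) (size-other t r≢t s≢t))))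

      weights : ∀ t → weight ℓ t ≡ moved ℓ c t + kept ℓ c t
      weights = part-split w ℓ c₀ c

      pair : φ r + φ s ≤ ψ r + ψ s
      pair = begin
        φ r + φ s
          ≡⟨ cong (λ i → φ r + (X s + 2 * i + Φ ℓ c s))
               (part-merge-from ℓ r≢s (differing w c₀ c′)) ⟩
        φ r + (X s + 0 + Φ ℓ c s)
          ≤⟨ lazy-regroup (X r) (X s) (moved ℓ′ c′ r) (moved ℓ c r) (moved ℓ c s)
               (Φ ℓ c r) (Φ ℓ c s) (Φ ℓ′ c′ r) (Φ ℓ′ c′ s) pays′ ⟩
        ψ r + ψ s ∎
        where
        open ≤-Reasoning
        pays′ : X r + X s + 2 * moved ℓ′ c′ r + (Φ ℓ c r + Φ ℓ c s)
              ≤ 2 * (moved ℓ c r + moved ℓ c s) + Φ ℓ′ c′ r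
        pays′ = begin
          X r + X s + 2 * moved ℓ′ c′ r + (Φ ℓ c r + Φ ℓ c s)
            ≡⟨ cong₂ (λ i j → i + 2 * j + (Φ ℓ c r + Φ ℓ c s))
                 (cong₂ _+_ (trans X-first (cong (flipCost x) (weights r)))
                            (trans X-second (cong (flipCost y) (weights s)))) moved-into ⟩
          _
            ≤⟨ pays ⟩
          _
            ≡⟨ cong (2 * (moved ℓ c r + moved ℓ c s) +_)
                 (trans (cong (λ k → potential (moved ℓ′ c′ r) (kept ℓ′ c′ r) (level k)) size-into)
                   (cong₂ (λ i j → potential i j (level (size ℓ r + size ℓ s)))
                     moved-into kept-into)) ⟨
          2 * (moved ℓ c r + moved ℓ c s) + Φ ℓ′ c′ r ∎

      φ≤ψ : recoloringCost w c c′ + 2 * ∑ (moved ℓ′ c′) + ∑ (Φ ℓ c)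
          ≤ 2 * ∑ (moved ℓ c) + ∑ (Φ ℓ′ c′)
      φ≤ψ = begin
        recoloringCost w c c′ + 2 * ∑ (moved ℓ′ c′) + ∑ (Φ ℓ c)
          ≡⟨ cong₂ (λ i j → i + j + ∑ (Φ ℓ c)) (recoloringCost-flip w ℓ β c)
               (sym (∑-*ˡ 2 (moved ℓ′ c′))) ⟩
        ∑ X + ∑ (λ t → 2 * moved ℓ′ c′ t) + ∑ (Φ ℓ c)
          ≡⟨ cong (_+ ∑ (Φ ℓ c)) (∑-+ X (λ t → 2 * moved ℓ′ c′ t)) ⟨
        ∑ (λ t → X t + 2 * moved ℓ′ c′ t) + ∑ (Φ ℓ c)
          ≡⟨ ∑-+ (λ t → X t + 2 * moved ℓ′ c′ t) (Φ ℓ c) ⟨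
        ∑ φ
          ≤⟨ ∑-mono-except φ ψ r≢s others pair ⟩
        ∑ ψ
          ≡⟨ ∑-+ (λ t → 2 * moved ℓ c t) (Φ ℓ′ c′) ⟩
        ∑ (λ t → 2 * moved ℓ c t) + ∑ (Φ ℓ′ c′)
          ≡⟨ cong (_+ ∑ (Φ ℓ′ c′)) (∑-*ˡ 2 (moved ℓ c)) ⟩
        2 * ∑ (moved ℓ c) + ∑ (Φ ℓ′ c′) ∎
        where open ≤-Reasoning

      account′ : T + recoloringCost w c c′ + 2 * ∑ (moved ℓ′ c′) ≤ ∑ (Φ ℓ′ c′)
      account′ = lazy-combine T (recoloringCost w c c′) (∑ (moved ℓ c)) (∑ (moved ℓ′ c′))
        (∑ (Φ ℓ c)) (∑ (Φ ℓ′ c′)) φ≤ψ account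

    eager-merge : ∀ {es T} →
      flipCost x (weight ℓ r) + flipCost y (weight ℓ s) + (Ψ ℓ r + Ψ ℓ s)
        ≤ (weight ℓ r + weight ℓ s) * ⌊log₂ (size ℓ r + size ℓ s) ⌋ →
      EagerLedger es ℓ c T → EagerLedger es ℓ′ c′ (T + recoloringCost w c c′)
    eager-merge {es} {T} pays K = record
      { bound = bound
      ; excess = excess + R
      ; lower = lower
      ; large = large
      ; loads = λ i → ≤-trans (classWeight-recolor w c c′ i)
                  (≤-trans (+-monoˡ-≤ R (loads i)) (≤-reflexive (+-assoc B excess R)))
      ; account = eager-combine m T R (∑ (Ψ ℓ)) (∑ (Ψ ℓ′)) excess
                    ((15 * suc L + 8 * m) * bound) φ≤ψ account
      }
      where
      open EagerLedger K
      R = recoloringCost w c c′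

      φ : Fin n → ℕ
      φ t = X t + Ψ ℓ t

      others : ∀ t → r ≢ t → s ≢ t → φ t ≤ Ψ ℓ′ t
      others t r≢t s≢t = ≤-reflexive (cong₂ _+_ (X-other t r≢t s≢t)
        (sym (cong₂ (λ i j → i * ⌊log₂ j ⌋)
          (part-merge-other ℓ r≢s w t r≢t s≢t) (size-other t r≢t s≢t))))

      pair : φ r + φ s ≤ Ψ ℓ′ r + Ψ ℓ′ s
      pair = eager-regroup (X r) (X s) (Ψ ℓ r) (Ψ ℓ s) (Ψ ℓ′ r) (Ψ ℓ′ s) (begin
        X r + X s + (Ψ ℓ r + Ψ ℓ s)
          ≡⟨ cong (_+ (Ψ ℓ r + Ψ ℓ s)) (cong₂ _+_ X-first X-second) ⟩
        flipCost x (weight ℓ r) + flipCost y (weight ℓ s) + (Ψ ℓ r + Ψ ℓ s)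
          ≤⟨ pays ⟩
        (weight ℓ r + weight ℓ s) * ⌊log₂ (size ℓ r + size ℓ s) ⌋
          ≡⟨ cong₂ (λ i j → i * ⌊log₂ j ⌋) (part-merge-into ℓ r≢s w) size-into ⟨
        Ψ ℓ′ r ∎)
        where open ≤-Reasoning

      φ≤ψ : R + ∑ (Ψ ℓ) ≤ ∑ (Ψ ℓ′)
      φ≤ψ = begin
        R + ∑ (Ψ ℓ)    ≡⟨ cong (_+ ∑ (Ψ ℓ)) (recoloringCost-flip w ℓ β c) ⟩
        ∑ X + ∑ (Ψ ℓ)  ≡⟨ ∑-+ X (Ψ ℓ) ⟨
        ∑ φ            ≤⟨ ∑-mono-except φ (Ψ ℓ′) r≢s others pair ⟩
        ∑ (Ψ ℓ′)       ∎
        where open ≤-Reasoning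

  Ledger-reconcile : ∀ μ {es ℓ c T} u v → ℓ u ≢ ℓ v → Ledger μ es ℓ c T →
    Ledger μ es (merge ℓ (ℓ u) (ℓ v)) (reconcile μ ℓ c u v)
      (T + recoloringCost w c (reconcile μ ℓ c u v))
  Ledger-reconcile lazy  {ℓ = ℓ} {c} u v ne =
    Merge.lazy-merge ℓ c ne _ _ (proj₂ (lazy-flip ℓ c u v))
  Ledger-reconcile eager {ℓ = ℓ} {c} u v ne =
    Merge.eager-merge ℓ c ne _ _ (proj₂ (eager-flip ℓ c u v))

  reconcile-proper : ∀ μ {es ℓ c} u v → ℓ u ≢ ℓ v → Components es ℓ → Proper es c →
    Proper ((u , v) ∷ es) (reconcile μ ℓ c u v)
  reconcile-proper μ {ℓ = ℓ} {c} u v ne K proper =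
    new ∷ flipBy-proper ℓ β (Components.closed K) proper
    where
    x = flip? μ ℓ c u v
    y = x xor does (c u ≟ c v)
    β = mask (ℓ u) x (ℓ v) y
    new : flipIf (β (ℓ u)) (c u) ≢ flipIf (β (ℓ v)) (c v)
    new rewrite mask-first ne x y | mask-second ne x y = flipIf-separates x (c u) (c v)

  weaken-cost : ∀ μ {es ℓ c T} → Ledger μ es ℓ c T → Ledger μ es ℓ c (T + recoloringCost w c c)
  weaken-cost μ {es} {ℓ} {c} {T} = Ledger-antitone μ (≤-reflexive (trans (cong (T +_)
    (trans (∑-cong (differing-refl w c)) (∑-zero n))) (+-identityʳ T)))

  -- For a proper `c` and its components this is the distance, on one component, of c₀ to the
  -- closest proper coloring; its sum is the D bounding the optimum below.
  drift : Labelling n → Coloring n → Fin n → ℕ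
  drift ℓ c t = moved ℓ c t ⊓ kept ℓ c t

  size≤n : ∀ ℓ t → size ℓ t ≤ n
  size≤n ℓ t = ≤-trans (part≤∑ ℓ (λ _ → 1) t) (≤-reflexive (∑-one n))

  -- 15 is the 3 of the potential times the 5 of `contested`.
  ∑Φ≤ : ∀ ℓ c → ∑ (Φ ℓ c) ≤ 15 * suc L * ∑ (drift ℓ c)
  ∑Φ≤ ℓ c = ≤-trans (∑-mono pointwise) (≤-reflexive (∑-*ˡ (15 * suc L) (drift ℓ c)))
    where
    pointwise : ∀ t → Φ ℓ c t ≤ 15 * suc L * drift ℓ c t
    pointwise t = potential≤ (moved ℓ c t) (kept ℓ c t) (s≤s (⌊log₂⌋-mono-≤ (size≤n ℓ t)))

  ∑Ψ≤ : ∀ ℓ → ∑ (Ψ ℓ) ≤ ∑ w * L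
  ∑Ψ≤ ℓ = begin
    ∑ (Ψ ℓ)
      ≤⟨ ∑-mono (λ t → *-mono-≤ (≤-refl {weight ℓ t}) (⌊log₂⌋-mono-≤ (size≤n ℓ t))) ⟩
    ∑ (λ t → weight ℓ t * L)       ≡⟨ ∑-cong (λ t → *-comm (weight ℓ t) L) ⟩
    ∑ (λ t → L * weight ℓ t)       ≡⟨ ∑-*ˡ L (weight ℓ) ⟩
    L * ∑ (weight ℓ)               ≡⟨ cong (L *_) (∑-part ℓ w) ⟩
    L * ∑ w                        ≡⟨ *-comm L (∑ w) ⟩
    ∑ w * L                        ∎
    where open ≤-Reasoning

  lazy-cost : ∀ {ℓ c T} → LazyLedger ℓ c T → T ≤ 15 * suc L * ∑ (drift ℓ c)
  lazy-cost {ℓ} {c} {T} K = ≤-trans (m≤m+n T _) (≤-trans (LazyLedger.account K) (∑Φ≤ ℓ c))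

  ∑moved≤ : ∀ {ℓ c T} → LazyLedger ℓ c T → ∑ (moved ℓ c) ≤ 4 * ∑ (drift ℓ c)
  ∑moved≤ {ℓ} {c} K = ≤-trans (∑-mono (λ t → m≤4[m⊓n] (LazyLedger.near K t)))
    (≤-reflexive (∑-*ˡ 4 (drift ℓ c)))

  start-ledger : LazyLedger (λ v → v) c₀ 0
  start-ledger = record
    { near    = λ t → ≤-trans (≤-reflexive (unmoved t)) z≤n
    ; account = ≤-trans (≤-reflexive (cong (2 *_) (trans (∑-cong unmoved) (∑-zero n)))) z≤n
    }
    where
    unmoved : ∀ t → moved (λ v → v) c₀ t ≡ 0
    unmoved t = part-zero (λ v → v) t (λ v _ → differing-refl w c₀ v)

  overflow : ∀ c {e} → ¬ Fits c → (∀ i → classWeight w c i ≤ B + e) → B ≤ m * e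
  overflow c {e} ¬fits loads with ¬∀⟶∃¬ 2 _ (λ i → m * classWeight w c i ≤? suc m * B) ¬fits
  ... | i , over = overflow-excess m B e _ (≰⇒> over) (loads i)

  -- The invariant along a run

  module Analysis (c₀-fits : Respects w (exactly B) c₀) (total : ∑ w ≤ 2 * B) where

    loads-moved : ∀ ℓ c i → classWeight w c i ≤ B + ∑ (moved ℓ c)
    loads-moved ℓ c i = ≤-trans (classWeight-recolor w c₀ c i)
      (+-mono-≤ (c₀-fits i) (≤-reflexive (sym (∑-part ℓ (differing w c₀ c)))))

    record Sound (S : State n) (T : ℕ) : Set where
      field
        components : Components (seen S) (labels S)
        proper     : Proper (seen S) (current S)
        fits       : Fits (current S)
        ledger     : Ledger (mode S) (seen S) (labels S) (current S) T

    balanced-fits : ∀ c → Respects w (exactly B) c → Fits c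
    balanced-fits c respects i = ≤-trans (*-monoʳ-≤ m (respects i)) (m≤n+m (m * B) B)

    Sound-start : Sound start 0
    Sound-start = record
      { components = Components-[]
      ; proper     = []
      ; fits       = balanced-fits c₀ c₀-fits
      ; ledger     = start-ledger
      }

    Ledger-rebalance : ∀ μ {es ℓ c T c′} → Components es ℓ → Proper es c → ¬ Fits c →
      Balanced w es c′ →
      Ledger μ es ℓ c T → EagerLedger es ℓ c′ (T + recoloringCost w c c′)
    Ledger-rebalance lazy {es} {ℓ} {c} {T} {c′} K proper ¬fits (_ , respects) Λ = record
      -- The distance at the moment of the switch is frozen as the lower bound for the rest of the
      -- run.
      { bound   = D
      ; excess  = 0
      ; lower   = recoloringCost-lower w ℓ c₀ c K proper
      ; large   = large
      ; loads   = λ i → ≤-trans (respects i) (m≤m+n B 0)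
      ; account = lazy-to-eager m (15 * suc L) B D _ (lazy-cost Λ)
                    (≤-trans (recoloringCost≤∑ w c c′) total) large
      }
      where
      D = ∑ (drift ℓ c)
      large : B ≤ 4 * m * D
      -- The load above B is at most the recolored weight, hence at most 4 D, and an overflow makes
      -- it at least B / m.
      large = ≤-trans (overflow c ¬fits (loads-moved ℓ c))
        (≤-trans (*-monoʳ-≤ m (∑moved≤ Λ)) (≤-reflexive (m*[4*d]≡4*m*d m D)))
    Ledger-rebalance eager {c = c} {T} {c′} K proper ¬fits (_ , respects) Λ = record
      { EagerLedger Λ
      ; excess  = 0
      ; loads   = λ i → ≤-trans (respects i) (m≤m+n B 0)
      ; account = ≤-trans
          (eager-refund m B (EagerLedger.excess Λ) T (≤-trans (recoloringCost≤∑ w c c′) total)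
            (overflow c ¬fits (EagerLedger.loads Λ)))
          (EagerLedger.account Λ)
      }

    settle-sound : ∀ μ {es ℓ c T} → Components es ℓ → Proper es c → ∃[ c* ] Balanced w es c* →
      Ledger μ es ℓ c T →
      let (μ′ , c′) = settle μ es c in
      Proper es c′ × Fits c′ × Ledger μ′ es ℓ c′ (T + recoloringCost w c c′)
    settle-sound μ {es} {c = c} K proper feasible Λ with fits? c | balanced? w es
    ... | yes fits | _ = proper , fits , weaken-cost μ Λ
    ... | no ¬fits | yes (c′ , bal) =
      proj₁ bal , balanced-fits c′ (proj₂ bal) , Ledger-rebalance μ K proper ¬fits bal Λ
    ... | no _ | no infeasible = contradiction feasible infeasible

    Sound-step : ∀ {S T} u v → Sound S T → ∃[ c* ] Balanced w ((u , v) ∷ seen S) c* →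
      Sound (step S (u , v)) (T + recoloringCost w (current S) (current (step S (u , v))))
    Sound-step {state μ es ℓ c} {T} u v snd (c* , cu≢cv ∷ p* , r*) with ℓ u ≟ ℓ v
    ... | yes same = record
      { components = Components-∷ same (Sound.components snd)
      ; proper     =
          -- An edge inside a component is already properly colored: the current coloring agrees
          -- with `c*` at both ends or at neither, and `c*` separates them.
          ≢-transport (Components.rigid (Sound.components snd) (Sound.proper snd) p* same) cu≢cv
            ∷ Sound.proper snd
      ; fits       = Sound.fits snd
      ; ledger     = Ledger-∷ μ (weaken-cost μ (Sound.ledger snd))
      }
    ... | no ne = record
      { components = K
      ; proper     = proj₁ settled
      ; fits       = proj₁ (proj₂ settled)
      ; ledger     = Ledger-antitone μ′ triangle (proj₂ (proj₂ settled))
      }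
      where
      c₁ = reconcile μ ℓ c u v
      μ′ = proj₁ (settle μ ((u , v) ∷ es) c₁)
      c₂ = proj₂ (settle μ ((u , v) ∷ es) c₁)
      K = Components-merge ne (Sound.components snd)
      settled = settle-sound μ K
        (reconcile-proper μ u v ne (Sound.components snd) (Sound.proper snd))
        (c* , cu≢cv ∷ p* , r*) (Ledger-∷ μ (Ledger-reconcile μ u v ne (Sound.ledger snd)))
      -- The ledger charges flip and rebalancing separately, while the algorithm pays for the direct
      -- change from `c` to `c₂`.
      triangle : T + recoloringCost w c c₂ ≤ T + recoloringCost w c c₁ + recoloringCost w c₁ c₂
      triangle = ≤-trans (+-monoʳ-≤ T (recoloringCost-triangle w c c₁ c₂))
        (≤-reflexive (sym (+-assoc T _ _)))

    seen-step : ∀ S e → seen (step S e) ≡ e ∷ seen S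
    seen-step (state μ es ℓ c) (u , v) with ℓ u ≟ ℓ v
    ... | yes _ = refl
    ... | no _  = refl

    seen-foldl : ∀ σ {S c} → Proper (seen S) c → Proper σ c → Proper (seen (foldl step S σ)) c
    seen-foldl []      p []       = p
    seen-foldl (e ∷ σ) {S} {c} p (q ∷ qs) =
      seen-foldl σ (subst (λ es → Proper es c) (sym (seen-step S e)) (q ∷ p)) qs

    outputs : ∀ S σ → Schedule σ
    outputs S σ t = current (foldl step S (prefix σ t))

    -- Generalised to an arbitrary sound state. Properness on `seen S` is part of the claim because
    -- the induction moves each request from the sequence into `seen`, from where the first edge of
    -- every prefix is recovered.
    Sound-run : ∀ σ {S T} → Sound S T →
      ∃[ c ] (Proper (seen S) c × Proper σ c × Respects w (exactly B) c) →
      (∀ t → Proper (seen S) (outputs S σ t) × Proper (prefix σ t) (outputs S σ t)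
           × Fits (outputs S σ t))
      × Sound (foldl step S σ) (T + cost w (current S) σ (outputs S σ))
    Sound-run [] {S} {T} snd _ = (λ ()) , subst (Sound S) (sym (+-identityʳ T)) snd
    Sound-run ((u , v) ∷ σ) {S} {T} snd (c , p , q ∷ qs , r) =
      feasible , subst (Sound _) cost-eq (proj₂ rest)
      where
      e = (u , v)
      S′ = step S e
      snd′ : Sound S′ (T + recoloringCost w (current S) (current S′))
      snd′ = Sound-step u v snd (c , q ∷ p , r)
      seen′ : ∀ {c′} → Proper (seen S′) c′ → Proper (e ∷ seen S) c′
      seen′ {c′} = subst (λ es → Proper es c′) (seen-step S e)
      rest = Sound-run σ snd′
        (c , subst (λ es → Proper es c) (sym (seen-step S e)) (q ∷ p) , qs , r)
      cost-eq : T + recoloringCost w (current S) (current S′) + cost w (current S′) σ (outputs S′ σ)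
              ≡ T + cost w (current S) (e ∷ σ) (outputs S (e ∷ σ))
      cost-eq = trans (+-assoc T _ _)
        (cong (T +_) (sym (cost-∷ w (current S) {e} {σ} (outputs S (e ∷ σ)))))
      feasible : ∀ t → Proper (seen S) (outputs S (e ∷ σ) t)
        × Proper (prefix (e ∷ σ) t) (outputs S (e ∷ σ) t) × Fits (outputs S (e ∷ σ) t)
      feasible 0F with seen′ (Sound.proper snd′)
      ... | q ∷ p = p , q ∷ [] , Sound.fits snd′
      feasible (suc t) with proj₁ rest t
      ... | p , qs , f with seen′ p
      ...   | q ∷ p = p , q ∷ qs , f

    Sound-cost : ∀ {S T} → 1 ≤ L → Sound S T → ∀ c′ → Proper (seen S) c′ →
      T ≤ competitiveness m * L * recoloringCost w c₀ c′
    Sound-cost {state lazy es ℓ c} {T} 1≤L snd c′ p = lazy-competitive m 1≤L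
      (≤-trans (lazy-cost (Sound.ledger snd)) (*-monoʳ-≤ (15 * suc L)
        (recoloringCost-lower w ℓ c₀ c (Sound.components snd) (Sound.proper snd) c′ p)))
    Sound-cost {state eager es ℓ c} {T} 1≤L snd c′ p = ≤-trans
      (eager-competitive m 1≤L
        -- All eager merging is charged to the optimum here: 2 B log n becomes 8 m D log n through
        -- `large`.
        (≤-trans (∑Ψ≤ ℓ) (≤-trans (*-monoˡ-≤ L total) (*-monoˡ-≤ L (*-monoʳ-≤ 2 large))))
        (≤-trans (m≤m+n T _) account))
      (*-monoʳ-≤ (competitiveness m * L) (lower c′ p))
      where open EagerLedger (Sound.ledger snd)

-- From rational to real capacities

Lower≤Upper : ∀ (ε : ℝ) {p q} → ℝ.Lower ε p → ℝ.Upper ε q → p ℚ.≤ q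
Lower≤Upper ε {p} {q} lower upper with ℚ.<-cmp p q
... | tri< p<q _ _ = ℚ.<⇒≤ p<q
... | tri≈ _ p≡q _ = ℚ.≤-reflexive p≡q
... | tri> _ _ q<p = contradiction
        (Equivalence.from (ℝ.lower-rounded ε q) (p , q<p , lower) , upper) (ℝ.disjoint ε q)

-- 1 + q ≥ (m + 1) / m for m the denominator of q > 0.
augment-denominator : ∀ q → 0ℚ ℚ.< q → ∀ x B → ↧ₙ q * x ≤ suc (↧ₙ q) * B →
  (ℤ.+ x ℚ./ 1) ℚ.≤ (1ℚ ℚ.+ q) ℚ.* (ℤ.+ B ℚ./ 1)
augment-denominator q@(mkℚ (ℤ.+ 0) d _) (ℚ.*<* (ℤ.+<+ ())) x B h
augment-denominator q@(mkℚ (ℤ.+ suc a) d _) _ x B h = ℚ.toℚᵘ-cancel-≤ (begin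
  ℚ.toℚᵘ (ℤ.+ x ℚ./ 1)
    ≃⟨ ℚ.toℚᵘ-fromℚᵘ (mkℚᵘ (ℤ.+ x) 0) ⟩
  mkℚᵘ (ℤ.+ x) 0
    ≤⟨ *≤* goal ⟩
  (ℚᵘ.1ℚᵘ ℚᵘ.+ ℚ.toℚᵘ q) ℚᵘ.* mkℚᵘ (ℤ.+ B) 0
    ≃⟨ ℚᵘ.*-cong (ℚᵘ.≃-sym (ℚ.toℚᵘ-homo-+ 1ℚ q))
                 (ℚᵘ.≃-sym (ℚ.toℚᵘ-fromℚᵘ (mkℚᵘ (ℤ.+ B) 0))) ⟩
  ℚ.toℚᵘ (1ℚ ℚ.+ q) ℚᵘ.* ℚ.toℚᵘ (ℤ.+ B ℚ./ 1)
    ≃⟨ ℚ.toℚᵘ-homo-* (1ℚ ℚ.+ q) (ℤ.+ B ℚ./ 1) ⟨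
  ℚ.toℚᵘ ((1ℚ ℚ.+ q) ℚ.* (ℤ.+ B ℚ./ 1)) ∎)
  where
  open ℚᵘ.≤-Reasoning
  r = (ℚᵘ.1ℚᵘ ℚᵘ.+ ℚ.toℚᵘ q) ℚᵘ.* mkℚᵘ (ℤ.+ B) 0
  goal : ℤ.+ x ℤ.* ℚᵘ.↧ r ℤ.≤ ℚᵘ.↥ r ℤ.* ℚᵘ.↧ (mkℚᵘ (ℤ.+ x) 0)
  goal = subst₂ ℤ._≤_ left right (ℤ.+≤+ sum)
    where
    sum : x * suc d ≤ (suc d + suc a) * B
    sum = ≤-trans (≤-reflexive (*-comm x (suc d)))
      (≤-trans h (*-monoˡ-≤ B
        (≤-trans (≤-reflexive (+-comm 1 (suc d))) (+-monoʳ-≤ (suc d) (s≤s z≤n)))))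
    left : ℤ.+ (x * suc d) ≡ ℤ.+ x ℤ.* ℚᵘ.↧ r
    left = trans (ℤ.pos-* x (suc d)) (cong (λ k → ℤ.+ x ℤ.* ℤ.+ k)
      (sym (trans (*-identityʳ (1 * suc d)) (*-identityˡ (suc d)))))
    right : ℤ.+ ((suc d + suc a) * B) ≡ ℚᵘ.↥ r ℤ.* ℤ.+ 1
    right = trans (ℤ.pos-* (suc d + suc a) B) (trans
      (cong (ℤ._* ℤ.+ B)
        (cong₂ ℤ._+_ (sym (ℤ.*-identityˡ (ℤ.+ suc d))) (sym (ℤ.*-identityʳ (ℤ.+ suc a)))))
      (sym (ℤ.*-identityʳ _)))

-- Every rational above ε is at least `q`, so the load bound with 1 + q carries over to each of
-- them.
augmented-suc : ∀ (ε : ℝ) {q} → 0ℚ ℚ.< q → ℝ.Lower ε q → ∀ B x →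
  (↧ₙ q) * x ≤ suc (↧ₙ q) * B → augmented ε B x
augmented-suc ε {q} 0<q lower B x h p upper = ℚ.≤-trans (augment-denominator q 0<q x B h)
  (ℚ.*-monoʳ-≤-nonNeg (ℤ.+ B ℚ./ 1) {{ℚ.normalize-nonNeg B 1}}
    (ℚ.+-monoʳ-≤ 1ℚ (Lower≤Upper ε lower upper)))

theorem3 : ∀ (ε : ℝ) → ε ∈⟨0,1⟩ →
    ∃[ K ] (∀ (n : ℕ) → 2 ≤ n →
    ∀ (w : Weights n) → AdmissibleWeights w →
    ∃[ A ] (∀ (c₀ : Coloring n) → Respects w (exactly (half w)) c₀ →
    ∀ (σ : List (Edge n)) → AdmissibleRequests w σ →
    Feasible w (augmented ε (half w)) σ (run A c₀ σ)
    × (∀ (opt : ℕ) → IsOPT w c₀ σ opt →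
    cost w c₀ σ (run A c₀ σ) ≤ K * ⌊log₂ n ⌋ * opt)))
theorem3 ε (0<ε , _) with Equivalence.to (ℝ.lower-rounded ε ℚ.0ℚ) 0<ε
-- Rounding yields a rational 0 < q < ε. Its denominator `m` satisfies 1/m ≤ q and depends on ε
-- alone, hence so does the constant.
... | q , 0<q , q<ε = competitiveness m , λ n 2≤n w adm →
      (λ c₀ σ → State.current (foldl (Algorithm.step w m c₀) (Algorithm.start w m c₀) σ)) ,
      λ c₀ c₀-fits σ (c , proper , respects) →
        let open Algorithm w m c₀
            open Analysis c₀-fits (total adm)
            (feasible , sound) = Sound-run σ Sound-start (c , [] , proper , respects)
        in (λ t → let (_ , p , fits) = feasible t
                  in p , λ i → augmented-suc ε 0<q q<ε (half w)
                                 (classWeight w (outputs start σ t) i) (fits i)) ,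
           λ { opt record { attained = s , s-feasible , refl } →
             -- A trivially true predicate starts the induction; what matters is that the last
             -- coloring of the optimal schedule is proper for all of `σ`.
             let (_ , s-proper) = final-proper w (λ _ → Proper {n} [] c₀) c₀ σ s [] (λ _ → [])
                                    (λ t → proj₁ (s-feasible t))
             in ≤-trans (Sound-cost (1≤log n 2≤n) sound (final w c₀ σ s) (seen-foldl σ [] s-proper))
                  (*-monoʳ-≤ (competitiveness m * ⌊log₂ n ⌋) (recoloringCost-final w c₀ σ s)) }
  where
  m = ↧ₙ q
  1≤log : ∀ n → 2 ≤ n → 1 ≤ ⌊log₂ n ⌋
  1≤log n 2≤n = ≤-trans (≤-reflexive (sym (⌊log₂[2^n]⌋≡n 1))) (⌊log₂⌋-mono-≤ 2≤n)
  total : ∀ {n} {w : Weights n} → AdmissibleWeights w → ∑ w ≤ 2 * half w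
  total {w = w} adm =
    ≤-reflexive (trans (sym (m/n*n≡m (AdmissibleWeights.even adm))) (*-comm (half w) 2))
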